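{- Let $T$ be a tree on $n$ vertices with $M(T)\geq 4$. Then $T$ is $3$-NIM if and only if $T$ is the simple star $S_n$.
   Context: The simple star $S_n$ is the tree $K_{1,n-1}$ (one central vertex adjacent to $n-1$ leaves). For a tree $T$ with vertex set $\{1,\dots,n\}$, $\mathcal{S}(T)$ denotes the set of real symmetric $n\times n$ matrices $A=(a_{ij})$ such that for $i\neq j$, $a_{ij}\neq 0$ if and only if $\{i,j\}$ is an edge of $T$. For $A\in\mathcal{S}(T)$ and $\lambda\in\mathbb{R}$, $\mathrm{m}_A(\lambda)$ is the multiplicity of $\lambda$ as an eigenvalue of $A$, and $M(T)$ is the maximum of $\mathrm{m}_A(\lambda)$ over all $A\in\mathcal{S}(T)$, $\lambda\in\mathbb{R}$. $T$ is $3$-NIM if $M(T)\geq 3$ and, whenever $A\in\mathcal{S}(T)$ has an eigenvalue $\lambda$ with $\mathrm{m}_A(\lambda)=M(T)-2\geq 2$, every other eigenvalue of $A$ has multiplicity $1$. -}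

module Defs where

open import Algebra.Bundles using (CommutativeRing)
open import Data.Fin.Base using (Fin; zero; suc; inject₁; fromℕ)
open import Data.Nat.Base as ℕ using (ℕ; _∸_)
open import Data.Product.Base using (∃; ∃-syntax; _×_)
open import Data.Sum.Base using (_⊎_)
open import Data.Vec.Functional using (Vector)
open import Function.Bundles using (_⇔_)
open import Function.Definitions using (Injective)
open import Level using (0ℓ)
open import Relation.Binary.Construct.Closure.ReflexiveTransitive using (Star)
open import Relation.Binary.Core using (Rel)
open import Relation.Binary.Definitions using (Symmetric; Irreflexive)
open import Relation.Binary.PropositionalEquality.Core using (_≡_; _≢_)
open import Relation.Binary.Structures using (IsTotalOrder)
open import Relation.Nullary.Negation.Core using (¬_)
open import Relation.Unary using (Pred)

-- The standard library has no real numbers, so they enter through their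
-- classical axioms: an ordered field with the least-upper-bound property.
-- Classically this determines ℝ up to a unique isomorphism.  The equality is
-- that of a setoid, so that Cauchy sequences of rationals can be a model.

record RealNumbers : Set₁ where
  infix 4 _≤_
  field
    commutativeRing : CommutativeRing 0ℓ 0ℓ

  open CommutativeRing commutativeRing public

  field
    _≤_          : Rel Carrier 0ℓ
    isTotalOrder : IsTotalOrder _≈_ _≤_
    1≉0          : ¬ (1# ≈ 0#)
    inverse      : ∀ x → ¬ (x ≈ 0#) → ∃[ y ] x * y ≈ 1#
    +-monoˡ-≤    : ∀ z {x y} → x ≤ y → x + z ≤ y + z
    *-nonNeg     : ∀ {x y} → 0# ≤ x → 0# ≤ y → 0# ≤ x * y

  UpperBound : Pred Carrier 0ℓ → Pred Carrier 0ℓ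
  UpperBound P b = ∀ x → P x → x ≤ b

  field
    supremum : (P : Pred Carrier 0ℓ) → ∃ P → ∃ (UpperBound P) →
               ∃[ s ] UpperBound P s × (∀ b → UpperBound P b → s ≤ b)

record Graph (n : ℕ) : Set₁ where
  field
    Adj    : Rel (Fin n) 0ℓ
    symm   : Symmetric Adj
    irrefl : Irreflexive _≡_ Adj

module _ {n : ℕ} (T : Graph n) where
  open Graph T

  Connected : Set
  Connected = ∀ i j → Star Adj i j

  -- c 0 , … , c (k + 2) are the k + 3 ≥ 3 distinct vertices of the cycle.
  record Cycle : Set where
    field
      k        : ℕ
      c        : Fin (3 ℕ.+ k) → Fin n
      distinct : Injective _≡_ _≡_ c
      step     : ∀ i → Adj (c (inject₁ i)) (c (suc i))
      close    : Adj (c (fromℕ (2 ℕ.+ k))) (c zero)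

  record IsTree : Set where
    field
      nonEmpty  : 0 ℕ.< n
      connected : Connected
      acyclic   : ¬ Cycle

  -- T is K₁,ₙ₋₁ : the edges are exactly those joining a centre z to each of
  -- the other n ∸ 1 vertices.
  IsSimpleStar : Set
  IsSimpleStar = ∃[ z ] ∀ i j → Adj i j ⇔ (i ≢ j × (i ≡ z ⊎ j ≡ z))

module _ (ℝ : RealNumbers) where
  open RealNumbers ℝ
  open import Algebra.Properties.Monoid.Sum +-monoid using (sum)

  Matrix : ℕ → Set
  Matrix n = Fin n → Fin n → Carrier

  -- The diagonal entries are unconstrained.
  record 𝒮 {n : ℕ} (T : Graph n) (A : Matrix n) : Set where
    open Graph T
    field
      symmetric : ∀ i j → A i j ≈ A j i
      support   : ∀ i j → i ≢ j → (¬ (A i j ≈ 0#)) ⇔ Adj i j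

  linearCombination : ∀ {n k} → Vector Carrier k → Vector (Vector Carrier n) k →
                      Vector Carrier n
  linearCombination a v i = sum (λ r → a r * v r i)

  Eigenspace : ∀ {n} → Matrix n → Carrier → Pred (Vector Carrier n) 0ℓ
  Eigenspace A μ x = ∀ i → sum (λ j → A i j * x j) ≈ μ * x i

  IsEigenvalue : ∀ {n} → Matrix n → Carrier → Set
  IsEigenvalue A μ = ∃[ x ] Eigenspace A μ x × ¬ (∀ i → x i ≈ 0#)

  -- m_A(μ) = m, as the dimension of the eigenspace; for real symmetric matrices
  -- this is also the algebraic multiplicity.  It is 0 when μ is not an
  -- eigenvalue.
  record HasMultiplicity {n : ℕ} (A : Matrix n) (μ : Carrier) (m : ℕ) : Set where
    field
      basis       : Vector (Vector Carrier n) m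
      inside      : ∀ r → Eigenspace A μ (basis r)
      independent : ∀ a → (∀ i → linearCombination a basis i ≈ 0#) →
                    ∀ r → a r ≈ 0#
      spanning    : ∀ x → Eigenspace A μ x →
                    ∃[ a ] ∀ i → x i ≈ linearCombination a basis i

  -- M(T) = M.
  record IsMaxMultiplicity {n : ℕ} (T : Graph n) (M : ℕ) : Set where
    field
      attained : ∃[ A ] 𝒮 T A × ∃[ μ ] HasMultiplicity A μ M
      maximal  : ∀ A → 𝒮 T A → ∀ μ m → HasMultiplicity A μ m → m ℕ.≤ M

  record Is3NIM {n : ℕ} (T : Graph n) : Set where
    field
      M      : ℕ
      isMax  : IsMaxMultiplicity T M
      3≤M    : 3 ℕ.≤ M
      simple : ∀ A → 𝒮 T A → ∀ μ → HasMultiplicity A μ (M ∸ 2) → 2 ℕ.≤ M ∸ 2 →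
               ∀ ν → ¬ (ν ≈ μ) → IsEigenvalue A ν → HasMultiplicity A ν 1

{-# OPTIONS --safe #-}
module Submission where

-- Eliminate the vertices of A − λ from the leaves of a rooted tree to its root.
-- As long as the pivots of the children of a vertex do not vanish, this is a
-- Schur complement; otherwise the vertex is paired with one child of vanishing
-- pivot, which cuts it off from the rest, and every further such child gives a
-- kernel vector.  Up to a possible one at the root, the multiplicity of λ is the
-- number of these.
--
-- In a star, a leaf with diagonal entry d has vanishing pivot only at λ = d, so
-- the multiplicities of two eigenvalues compete for the leaves.
--
-- Conversely, take A attaining M(T), and realise its pattern of vanishing pivots
-- anew at the eigenvalue 0, together with some at −1.  If exactly two children of
-- a vertex have vanishing pivot, then these two can be made to vanish at −1
-- instead, which moves one unit of multiplicity; two such vertices are enough.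
-- If three or more do, two of them are made to vanish at −1 instead, which costs
-- two units, and a third branch of the vertex is needed for two units at −1.  A
-- third branch with more than one vertex can have vanishing pivot at both
-- eigenvalues, since the weight of one of its edges is free; so can what remains
-- of the tree above the vertex.  Only in a star neither is available.

open import Defs
open import Algebra.Bundles using (CommutativeMonoid; RawRing)
import Algebra.Properties.CommutativeSemigroup
import Algebra.Properties.Ring
import Algebra.Properties.Semiring.Mult
import Algebra.Properties.Semiring.Sum
import Algebra.Solver.Ring
open import Algebra.Solver.Ring.AlmostCommutativeRing using (fromCommutativeRing; _-Raw-AlmostCommutative⟶_)
open import Axiom.ExcludedMiddle using (ExcludedMiddle)
open import Data.Empty using (⊥; ⊥-elim)
open import Data.Fin.Base using (Fin; zero; suc; inject₁; fromℕ; punchIn; _↑ˡ_; _↑ʳ_; fromℕ<)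
open import Data.Fin.Permutation using (Permutation; _⟨$⟩ʳ_)
open import Data.Fin.Properties using (+↔⊎; 0↔⊥; splitAt-↑ˡ; splitAt-↑ʳ)
import Data.Maybe.Base as Maybe
open import Data.Maybe.Base using (Maybe; just; nothing)
import Data.Nat.Base as ℕ
open import Data.Nat.Base using (ℕ; zero; suc; _∸_; s≤s; z≤n)
import Data.Nat.Properties as ℕ
open import Data.Product.Base using (∃; ∃-syntax; _×_; _,_; proj₁; proj₂)
open import Data.Sum.Base using (_⊎_; inj₁; inj₂; [_,_]′)
open import Data.Sum.Function.Propositional using (_⊎-↔_)
open import Data.Unit.Base using (⊤; tt)
open import Data.Vec.Functional using (Vector; insertAt)
open import Data.Vec.Functional.Properties using (insertAt-lookup; insertAt-punchIn)
open import Function.Base using (_∘_)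
open import Function.Bundles using (_↔_; mk↔ₛ′; Inverse; _⇔_; mk⇔; Equivalence)
open import Function.Construct.Composition using (_↔-∘_)
open import Function.Construct.Symmetry using (↔-sym)
open import Function.Definitions using (Injective)
open import Level using (0ℓ)
open import Relation.Binary.Consequences using (dec⇒weaklyDec)
open import Relation.Binary.Construct.Closure.ReflexiveTransitive using (Star; ε; _◅_)
import Relation.Binary.PropositionalEquality as ≡
open import Relation.Binary.PropositionalEquality using (_≡_; _≢_)
open import Relation.Binary.Structures using (IsTotalOrder)
open import Relation.Nullary.Decidable.Core using (Dec; yes; no)
open import Relation.Nullary.Negation.Core using (¬_)

-- Rooted trees

infixl 5 _◁_

-- t ◁ s attaches s to t by an edge between their roots; its root is that of t.
data Tree : Set where
  •   : Tree
  _◁_ : Tree → Tree → Tree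

data Vertex : Tree → Set where
  top   : Vertex •
  left  : ∀ {t s} → Vertex t → Vertex (t ◁ s)
  right : ∀ {t s} → Vertex s → Vertex (t ◁ s)

root : ∀ t → Vertex t
root •       = top
root (t ◁ s) = left (root t)

data Edge : ∀ {t} → Vertex t → Vertex t → Set where
  left  : ∀ {t s} {u v : Vertex t} → Edge u v → Edge {t ◁ s} (left u) (left v)
  right : ∀ {t s} {u v : Vertex s} → Edge u v → Edge {t ◁ s} (right u) (right v)
  down  : ∀ {t s} → Edge {t ◁ s} (left (root t)) (right (root s))
  up    : ∀ {t s} → Edge {t ◁ s} (right (root s)) (left (root t))

left-injective : ∀ {t s} {u v : Vertex t} → left {t} {s} u ≡ left v → u ≡ v
left-injective ≡.refl = ≡.refl

right-injective : ∀ {t s} {u v : Vertex s} → right {t} {s} u ≡ right v → u ≡ v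
right-injective ≡.refl = ≡.refl

left≢right : ∀ {t s} {u : Vertex t} {v : Vertex s} → left u ≢ right v
left≢right ()

-- Simple paths in rooted trees.

data Walk {t} : Vertex t → Vertex t → ℕ → Set where
  []  : ∀ {u} → Walk u u 0
  _∷_ : ∀ {u v w ℓ} → Edge u v → Walk v w ℓ → Walk u w (suc ℓ)

vertexAt : ∀ {t} {u v : Vertex t} {ℓ} → Walk u v ℓ → Fin (suc ℓ) → Vertex t
vertexAt {u = u} _ zero    = u
vertexAt (_ ∷ p)   (suc i) = vertexAt p i

vertexAt-last : ∀ {t} {u v : Vertex t} {ℓ} (p : Walk u v ℓ) → vertexAt p (fromℕ ℓ) ≡ v
vertexAt-last []      = ≡.refl
vertexAt-last (_ ∷ p) = vertexAt-last p

vertexAt-step : ∀ {t} {u v : Vertex t} {ℓ} (p : Walk u v ℓ) i →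
  Edge (vertexAt p (inject₁ i)) (vertexAt p (suc i))
vertexAt-step (e ∷ p) zero    = e
vertexAt-step (_ ∷ p) (suc i) = vertexAt-step p i

Simple : ∀ {t} {u v : Vertex t} {ℓ} → Walk u v ℓ → Set
Simple []                = ⊤
Simple (_∷_ {u = u} _ p) = (∀ i → u ≢ vertexAt p i) × Simple p

Simple⇒injective : ∀ {t} {u v : Vertex t} {ℓ} (p : Walk u v ℓ) → Simple p →
  Injective _≡_ _≡_ (vertexAt p)
Simple⇒injective p _ {zero} {zero} _ = ≡.refl
Simple⇒injective (_ ∷ p) (u∉p , _) {zero} {suc j} eq = ⊥-elim (u∉p j eq)
Simple⇒injective (_ ∷ p) (u∉p , _) {suc i} {zero} eq = ⊥-elim (u∉p i (≡.sym eq))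
Simple⇒injective (_ ∷ p) (_ , s) {suc i} {suc j} eq = ≡.cong suc (Simple⇒injective p s eq)

map-left : ∀ {t s} {u v : Vertex t} {ℓ} → Walk u v ℓ → Walk {t ◁ s} (left u) (left v) ℓ
map-left []      = []
map-left (e ∷ p) = left e ∷ map-left p

map-right : ∀ {t s} {u v : Vertex s} {ℓ} → Walk u v ℓ → Walk {t ◁ s} (right u) (right v) ℓ
map-right []      = []
map-right (e ∷ p) = right e ∷ map-right p

vertexAt-left : ∀ {t s} {u v : Vertex t} {ℓ} (p : Walk u v ℓ) i →
  vertexAt (map-left {s = s} p) i ≡ left (vertexAt p i)
vertexAt-left p       zero    = ≡.refl
vertexAt-left (_ ∷ p) (suc i) = vertexAt-left p i

vertexAt-right : ∀ {t s} {u v : Vertex s} {ℓ} (p : Walk u v ℓ) i →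
  vertexAt (map-right {t = t} p) i ≡ right (vertexAt p i)
vertexAt-right p       zero    = ≡.refl
vertexAt-right (_ ∷ p) (suc i) = vertexAt-right p i

Simple-left : ∀ {t s} {u v : Vertex t} {ℓ} (p : Walk u v ℓ) → Simple p → Simple (map-left {s = s} p)
Simple-left []      _         = tt
Simple-left (_ ∷ p) (u∉p , s) =
  (λ i eq → u∉p i (left-injective (≡.trans eq (vertexAt-left p i)))) , Simple-left p s

Simple-right : ∀ {t s} {u v : Vertex s} {ℓ} (p : Walk u v ℓ) → Simple p → Simple (map-right {t = t} p)
Simple-right []      _         = tt
Simple-right (_ ∷ p) (u∉p , s) =
  (λ i eq → u∉p i (right-injective (≡.trans eq (vertexAt-right p i)))) , Simple-right p s

connect : ∀ {t} {u v w x : Vertex t} {k ℓ} → Walk u v k → Edge v w → Walk w x ℓ → Walk u x (k ℕ.+ suc ℓ)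
connect []      e q = e ∷ q
connect (d ∷ p) e q = d ∷ connect p e q

vertexAt-connect : ∀ {t} {u v w x : Vertex t} {k ℓ} (P : Vertex t → Set)
  (p : Walk u v k) (e : Edge v w) (q : Walk w x ℓ) →
  (∀ i → P (vertexAt p i)) → (∀ i → P (vertexAt q i)) → ∀ i → P (vertexAt (connect p e q) i)
vertexAt-connect P []      e q Pp Pq zero    = Pp zero
vertexAt-connect P []      e q Pp Pq (suc i) = Pq i
vertexAt-connect P (d ∷ p) e q Pp Pq zero    = Pp zero
vertexAt-connect P (d ∷ p) e q Pp Pq (suc i) = vertexAt-connect P p e q (Pp ∘ suc) Pq i

Simple-connect : ∀ {t} {u v w x : Vertex t} {k ℓ} (p : Walk u v k) (e : Edge v w) (q : Walk w x ℓ) →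
  Simple p → Simple q → (∀ i j → vertexAt p i ≢ vertexAt q j) → Simple (connect p e q)
Simple-connect []      e q _         sq p∩q = p∩q zero , sq
Simple-connect (_∷_ {u = u} d p) e q (u∉p , sp) sq p∩q =
  vertexAt-connect (u ≢_) p e q u∉p (p∩q zero) , Simple-connect p e q sp sq (p∩q ∘ suc)

-- Between vertices on different sides of the joining edge the path runs through both roots; its two
-- halves are disjoint because they lie on different sides.
path : ∀ {t} (u v : Vertex t) → ∃[ ℓ ] ∃ λ (p : Walk u v ℓ) → Simple p
path top top = 0 , [] , tt
path (left u) (left v) with path u v
... | _ , p , s = _ , map-left p , Simple-left p s
path (right u) (right v) with path u v
... | _ , p , s = _ , map-right p , Simple-right p s
path {t ◁ s} (left u) (right v) with path u (root t) | path (root s) v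
... | _ , p , sp | _ , q , sq = _ , connect (map-left p) down (map-right q) ,
  Simple-connect (map-left p) down (map-right q) (Simple-left p sp) (Simple-right q sq)
    (λ i j eq → left≢right (≡.trans (≡.sym (vertexAt-left p i)) (≡.trans eq (vertexAt-right q j))))
path {t ◁ s} (right u) (left v) with path u (root s) | path (root t) v
... | _ , p , sp | _ , q , sq = _ , connect (map-right p) up (map-left q) ,
  Simple-connect (map-right p) up (map-left q) (Simple-right p sp) (Simple-left q sq)
    (λ i j eq → left≢right (≡.sym (≡.trans (≡.sym (vertexAt-right p i)) (≡.trans eq (vertexAt-left q j)))))

-- Growing a tree by a leaf.

sprout : ∀ {t} → Vertex t → Tree
sprout top               = • ◁ •
sprout {_ ◁ s} (left v)  = sprout v ◁ s
sprout {t ◁ _} (right v) = t ◁ sprout v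

-- The old vertices are not embedded into the larger tree; only their labels are transported, since
-- the labelling is all that ties a tree to a graph.
label-sprout : ∀ {A : Set} {t} (v : Vertex t) → (Vertex t → A) → A → Vertex (sprout v) → A
label-sprout top       f i (left _)  = f top
label-sprout top       f i (right _) = i
label-sprout (left v)  f i (left x)  = label-sprout v (f ∘ left) i x
label-sprout (left v)  f i (right x) = f (right x)
label-sprout (right v) f i (left x)  = f (left x)
label-sprout (right v) f i (right x) = label-sprout v (f ∘ right) i x

module _ {A : Set} where

  label-old : ∀ {t} (v : Vertex t) (f : Vertex t → A) i u → ∃[ x ] label-sprout v f i x ≡ f u
  label-old top       f i top       = left top , ≡.refl
  label-old (left v)  f i (right u) = right u , ≡.refl
  label-old (right v) f i (left u)  = left u , ≡.refl
  label-old (left v)  f i (left u)  with label-old v (f ∘ left) i u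
  ... | x , eq = left x , eq
  label-old (right v) f i (right u) with label-old v (f ∘ right) i u
  ... | x , eq = right x , eq

  label-new : ∀ {t} (v : Vertex t) (f : Vertex t → A) i → ∃[ x ] label-sprout v f i x ≡ i
  label-new top       f i = right top , ≡.refl
  label-new (left v)  f i with label-new v (f ∘ left) i
  ... | x , eq = left x , eq
  label-new (right v) f i with label-new v (f ∘ right) i
  ... | x , eq = right x , eq

  label-cases : ∀ {t} (v : Vertex t) (f : Vertex t → A) i x →
    label-sprout v f i x ≡ i ⊎ ∃[ u ] label-sprout v f i x ≡ f u
  label-cases top       f i (left _)  = inj₂ (top , ≡.refl)
  label-cases top       f i (right _) = inj₁ ≡.refl
  label-cases (left v)  f i (right x) = inj₂ (right x , ≡.refl)
  label-cases (right v) f i (left x)  = inj₂ (left x , ≡.refl)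
  label-cases (left v)  f i (left x)  with label-cases v (f ∘ left) i x
  ... | inj₁ eq       = inj₁ eq
  ... | inj₂ (u , eq) = inj₂ (left u , eq)
  label-cases (right v) f i (right x) with label-cases v (f ∘ right) i x
  ... | inj₁ eq       = inj₁ eq
  ... | inj₂ (u , eq) = inj₂ (right u , eq)

  label-sprout-root : ∀ {t} (v : Vertex t) (f : Vertex t → A) i →
    label-sprout v f i (root (sprout v)) ≡ f (root t)
  label-sprout-root top       f i = ≡.refl
  label-sprout-root (left v)  f i = label-sprout-root v (f ∘ left) i
  label-sprout-root (right v) f i = ≡.refl

  module _ {i : A} where

    label-fresh : ∀ {t} (v : Vertex t) (f : Vertex t → A) x {a} →
      i ≢ a → (∀ u → f u ≢ a) → label-sprout v f i x ≢ a
    label-fresh v f x i≢a f≢a eq with label-cases v f i x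
    ... | inj₁ eq′       = i≢a (≡.trans (≡.sym eq′) eq)
    ... | inj₂ (u , eq′) = f≢a u (≡.trans (≡.sym eq′) eq)

    label-injective : ∀ {t} (v : Vertex t) (f : Vertex t → A) →
      Injective _≡_ _≡_ f → (∀ u → f u ≢ i) → Injective _≡_ _≡_ (label-sprout v f i)
    label-injective top f inj f≢i {left top} {left top} eq = ≡.refl
    label-injective top f inj f≢i {right top} {right top} eq = ≡.refl
    label-injective top f inj f≢i {left _} {right _} eq = ⊥-elim (f≢i top eq)
    label-injective top f inj f≢i {right _} {left _} eq = ⊥-elim (f≢i top (≡.sym eq))
    label-injective (left v) f inj f≢i {left x} {left y} eq =
      ≡.cong left (label-injective v (f ∘ left) (left-injective ∘ inj) (f≢i ∘ left) eq)
    label-injective (left v) f inj f≢i {right x} {right y} eq = ≡.cong right (right-injective (inj eq))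
    label-injective (left v) f inj f≢i {left x} {right y} eq =
      ⊥-elim (label-fresh v (f ∘ left) x (f≢i (right y) ∘ ≡.sym) (λ u e → left≢right (inj e)) eq)
    label-injective (left v) f inj f≢i {right y} {left x} eq =
      ⊥-elim (label-fresh v (f ∘ left) x (f≢i (right y) ∘ ≡.sym) (λ u e → left≢right (inj e)) (≡.sym eq))
    label-injective (right v) f inj f≢i {left x} {left y} eq = ≡.cong left (left-injective (inj eq))
    label-injective (right v) f inj f≢i {right x} {right y} eq =
      ≡.cong right (label-injective v (f ∘ right) (right-injective ∘ inj) (f≢i ∘ right) eq)
    label-injective (right v) f inj f≢i {right x} {left y} eq =
      ⊥-elim (label-fresh v (f ∘ right) x (f≢i (left y) ∘ ≡.sym) (λ u e → left≢right (≡.sym (inj e))) eq)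
    label-injective (right v) f inj f≢i {left y} {right x} eq =
      ⊥-elim (label-fresh v (f ∘ right) x (f≢i (left y) ∘ ≡.sym) (λ u e → left≢right (≡.sym (inj e))) (≡.sym eq))

  label-edge : ∀ {R : A → A → Set} {i t} (v : Vertex t) (f : Vertex t → A) → (∀ {a b} → R a b → R b a) →
    (∀ {x y} → Edge x y → R (f x) (f y)) → R (f v) i →
    ∀ {x y} → Edge x y → R (label-sprout v f i x) (label-sprout v f i y)
  label-edge top       f sy fe r down      = r
  label-edge top       f sy fe r up        = sy r
  label-edge {R} (left v)  f sy fe r (left e)  = label-edge {R} v (f ∘ left) sy (fe ∘ left) r e
  label-edge (left v)  f sy fe r (right e) = fe (right e)
  label-edge {R} {i} (left v)  f sy fe r down =
    ≡.subst (λ a → R a (f (right (root _)))) (≡.sym (label-sprout-root v (f ∘ left) i)) (fe down)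
  label-edge {R} {i} (left v)  f sy fe r up   =
    ≡.subst (R (f (right (root _)))) (≡.sym (label-sprout-root v (f ∘ left) i)) (fe up)
  label-edge (right v) f sy fe r (left e)  = fe (left e)
  label-edge {R} (right v) f sy fe r (right e) = label-edge {R} v (f ∘ right) sy (fe ∘ right) r e
  label-edge {R} {i} (right v) f sy fe r down =
    ≡.subst (R (f (left (root _)))) (≡.sym (label-sprout-root v (f ∘ right) i)) (fe down)
  label-edge {R} {i} (right v) f sy fe r up   =
    ≡.subst (λ a → R a (f (left (root _)))) (≡.sym (label-sprout-root v (f ∘ right) i)) (fe up)

-- Graphs that are trees as rooted trees

module _ (em : ExcludedMiddle 0ℓ) {n : ℕ} (T : Graph n) where
  open Graph T

  record Subtree (r : Fin n) : Set where
    field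
      tree       : Tree
      label      : Vertex tree → Fin n
      injective  : Injective _≡_ _≡_ label
      label-root : label (root tree) ≡ r
      adjacent   : ∀ {u v} → Edge u v → Adj (label u) (label v)

    Contains : Fin n → Set
    Contains i = ∃[ u ] label u ≡ i

  open Subtree

  singleton : ∀ r → Subtree r
  singleton r = record
    { tree = • ; label = λ _ → r ; injective = λ { {top} {top} _ → ≡.refl }
    ; label-root = ≡.refl ; adjacent = λ () }

  -- Each vertex of the walk that is not yet a label is hung as a new leaf on its predecessor; being
  -- new, it keeps the labelling injective.
  reach : ∀ {r i j} → Star Adj i j → (S : Subtree r) → Contains S i →
    ∃[ S′ ] Contains S′ j × (∀ {k} → Contains S k → Contains {r} S′ k)
  reach ε S c = S , c , λ c → c
  reach {r} (_◅_ {j = j} a as) S (u , eq) with em {Contains S j}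
  ... | yes c = reach as S c
  ... | no ¬c with reach as grown (label-new u (label S) j)
    where
    grown : Subtree r
    grown = record
      { tree = sprout u ; label = label-sprout u (label S) j
      ; injective = label-injective u (label S) (injective S) (λ v e → ¬c (v , e))
      ; label-root = ≡.trans (label-sprout-root u (label S) j) (label-root S)
      ; adjacent = label-edge {R = Adj} u (label S) symm (adjacent S) (≡.subst (λ i → Adj i j) (≡.sym eq) a) }
  ... | S′ , c′ , mono = S′ , c′ , λ { (v , e) →
    let (x , e′) = label-old u (label S) j v in mono (x , ≡.trans e′ e) }

  record Encoding (r : Fin n) : Set where
    field
      subtree    : Subtree r
      surjective : ∀ i → Contains subtree i
      edge       : ∀ {u v} → Adj (label subtree u) (label subtree v) → Edge u v
    open Subtree subtree public

  reach-all : Connected T → ∀ r {m} (g : Fin m → Fin n) → ∃[ S ] Contains {r} S r × ∀ i → Contains {r} S (g i)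
  reach-all con r {zero} g = singleton r , (top , ≡.refl) , λ ()
  reach-all con r {suc m} g with reach-all con r (g ∘ suc)
  ... | S , cr , c with reach (con r (g zero)) S cr
  ... | S′ , c′ , mono = S′ , mono cr , λ { zero → c′ ; (suc i) → mono (c i) }

  -- Acyclicity yields the converse of `adjacent`: if adjacent vertices were joined in the tree by a
  -- path of length at least 2, that path and the adjacency would form a cycle.
  encode : IsTree T → ∀ r → Encoding r
  encode isTree r with reach-all (IsTree.connected isTree) r (λ i → i)
  ... | S , _ , c = record { subtree = S ; surjective = c ; edge = edge }
    where
    edge : ∀ {u v} → Adj (label S u) (label S v) → Edge u v
    edge {u} {v} a with path u v
    ... | 0 , [] , _ = ⊥-elim (irrefl ≡.refl a)
    ... | 1 , e ∷ [] , _ = e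
    ... | suc (suc k) , p , s = ⊥-elim (IsTree.acyclic isTree (record
      { k = k ; c = label S ∘ vertexAt p
      ; distinct = Simple⇒injective p s ∘ injective S
      ; step = λ i → adjacent S (vertexAt-step p i)
      ; close = ≡.subst (λ w → Adj (label S w) (label S u)) (≡.sym (vertexAt-last p)) (symm a) }))

-- Stars as rooted trees.

data Flat : Tree → Set where
  •    : Flat •
  _◁• : ∀ {t} → Flat t → Flat (t ◁ •)

-- A star may be rooted at its centre or at a leaf; in `tip` the root is the leaf `•` and the centre
-- is the root of `s`.
data Starlike : Tree → Set where
  centre : ∀ {t} → Flat t → Starlike t
  tip    : ∀ {s} → Flat s → Starlike (• ◁ s)

leaves : ∀ {t} → Flat t → ℕ
leaves •      = 0
leaves (f ◁•) = suc (leaves f)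

flat-to-root : ∀ {t} → Flat t → ∀ {u v} → Edge {t} u v → u ≡ root t ⊎ v ≡ root t
flat-to-root (f ◁•) (left e) with flat-to-root f e
... | inj₁ eq = inj₁ (≡.cong left eq)
... | inj₂ eq = inj₂ (≡.cong left eq)
flat-to-root (f ◁•) down = inj₁ ≡.refl
flat-to-root (f ◁•) up   = inj₂ ≡.refl

flat-from-root : ∀ {t} → Flat t → ∀ v → v ≢ root t → Edge (root t) v
flat-from-root •      top       v≢root = ⊥-elim (v≢root ≡.refl)
flat-from-root (f ◁•) (left v)  v≢root = left (flat-from-root f v (v≢root ∘ ≡.cong left))
flat-from-root (f ◁•) (right top) _    = down

-- A branch with more than one vertex would contain an edge that misses the root.
to-root-flat : ∀ t → (∀ {u v} → Edge {t} u v → u ≡ root t ⊎ v ≡ root t) → Flat t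
to-root-flat •       _ = •
to-root-flat (t ◁ •) h = to-root-flat t to-root ◁•
  where
  to-root : ∀ {u v} → Edge {t} u v → u ≡ root t ⊎ v ≡ root t
  to-root e with h (left e)
  ... | inj₁ eq = inj₁ (left-injective eq)
  ... | inj₂ eq = inj₂ (left-injective eq)
to-root-flat (t ◁ (s ◁ q)) h with h (right down)
... | inj₁ ()
... | inj₂ ()

starlike-centre : ∀ {t} → Starlike t →
  ∃[ c ] (∀ {u v} → Edge {t} u v → u ≡ c ⊎ v ≡ c) × (∀ v → v ≢ c → Edge c v)
starlike-centre {t} (centre f) = root t , flat-to-root f , flat-from-root f
starlike-centre (tip {s} f) = right (root s) , to , from
  where
  to : ∀ {u v} → Edge {• ◁ s} u v → u ≡ right (root s) ⊎ v ≡ right (root s)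
  to (right e) with flat-to-root f e
  ... | inj₁ eq = inj₁ (≡.cong right eq)
  ... | inj₂ eq = inj₂ (≡.cong right eq)
  to down = inj₂ ≡.refl
  to up   = inj₁ ≡.refl
  from : ∀ v → v ≢ right (root s) → Edge {• ◁ s} (right (root s)) v
  from (left top) _  = up
  from (right v) v≢c = right (flat-from-root f v (v≢c ∘ ≡.cong right))

module OverReals (em : ExcludedMiddle 0ℓ) (ℝ : RealNumbers) where

  open RealNumbers ℝ hiding (zero)
  open import Relation.Binary.Reasoning.Setoid setoid
  open Algebra.Properties.Ring ring
    using (-‿distribˡ-*; -‿distribʳ-*; -‿+-comm; -0#≈0#; -‿involutive)
    renaming (+-cancelʳ to +-cancelʳ-≈)
  open Algebra.Properties.Semiring.Mult semiring
    using (×-homo-+; ×1-homo-*) renaming (_×_ to _×ₙ_)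

  private
    module +S = Algebra.Properties.CommutativeSemigroup
      (CommutativeMonoid.commutativeSemigroup +-commutativeMonoid)

  -- Ordered fields

  -- Equality of reals is decided only by `em`, which does not compute; the ring solver therefore
  -- works with integer coefficients.
  module IntegerSolver where
    reduce : ℕ × ℕ → ℕ × ℕ
    reduce (suc m , suc n) = reduce (m , n)
    reduce p               = p

    -- (m , n) stands for the integer m − n; it is kept reduced, as the solver
    -- compares normal forms definitionally.
    Coefficient : RawRing 0ℓ 0ℓ
    Coefficient = record
      { Carrier = ℕ × ℕ ; _≈_ = _≡_
      ; _+_ = λ (m , n) (m′ , n′) → reduce (m ℕ.+ m′ , n ℕ.+ n′)
      ; _*_ = λ (m , n) (m′ , n′) → reduce (m ℕ.* m′ ℕ.+ n ℕ.* n′ , m ℕ.* n′ ℕ.+ n ℕ.* m′)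
      ; -_ = λ (m , n) → n , m
      ; 0# = 0 , 0 ; 1# = 1 , 0 }

    value : ℕ → Carrier
    value n = n ×ₙ 1#

    difference : ℕ × ℕ → Carrier
    difference (m , n) = value m + - value n

    -- The first two clauses make the constants 0 and 1 of the solver evaluate to
    -- 0# and 1# themselves.
    ⟦_⟧ : ℕ × ℕ → Carrier
    ⟦ 0 , 0 ⟧ = 0#
    ⟦ 1 , 0 ⟧ = 1#
    ⟦ m , n ⟧ = difference (m , n)

    ⟦⟧≈difference : ∀ p → ⟦ p ⟧ ≈ difference p
    ⟦⟧≈difference (0 , 0) = sym (-‿inverseʳ 0#)
    ⟦⟧≈difference (0 , suc n) = refl
    ⟦⟧≈difference (1 , 0) = sym (trans (+-cong (+-identityʳ 1#) -0#≈0#) (+-identityʳ 1#))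
    ⟦⟧≈difference (1 , suc n) = refl
    ⟦⟧≈difference (suc (suc m) , n) = refl

    interchange⁻ : ∀ a b c d → (a + b) + - (c + d) ≈ (a + - c) + (b + - d)
    interchange⁻ a b c d = trans (+-congˡ (sym (-‿+-comm c d))) (+S.interchange a b (- c) (- d))

    difference-reduce : ∀ p → difference (reduce p) ≈ difference p
    difference-reduce (0 , n)         = refl
    difference-reduce (suc m , 0)     = refl
    difference-reduce (suc m , suc n) = trans (difference-reduce (m , n)) (sym (begin
      (1# + value m) + - (1# + value n)  ≈⟨ interchange⁻ _ _ _ _ ⟩
      (1# + - 1#) + difference (m , n)   ≈⟨ +-congʳ (-‿inverseʳ 1#) ⟩
      0# + difference (m , n)            ≈⟨ +-identityˡ _ ⟩
      difference (m , n)                 ∎))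

    ⟦reduce⟧ : ∀ p → ⟦ reduce p ⟧ ≈ difference p
    ⟦reduce⟧ p = trans (⟦⟧≈difference (reduce p)) (difference-reduce p)

    *-homo : ∀ m n m′ n′ →
      difference (m ℕ.* m′ ℕ.+ n ℕ.* n′ , m ℕ.* n′ ℕ.+ n ℕ.* m′) ≈
      difference (m , n) * difference (m′ , n′)
    *-homo m n m′ n′ = begin
      value (m ℕ.* m′ ℕ.+ n ℕ.* n′) + - value (m ℕ.* n′ ℕ.+ n ℕ.* m′)
        ≈⟨ +-cong (values m m′ n n′) (-‿cong (values m n′ n m′)) ⟩
      (a * c + b * d) + - (a * d + b * c)
        ≈⟨ interchange⁻ _ _ _ _ ⟩
      (a * c + - (a * d)) + (b * d + - (b * c))
        ≈⟨ +-cong (+-congˡ (-‿distribʳ-* a d)) (+-comm _ _) ⟩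
      (a * c + a * - d) + (- (b * c) + b * d)
        ≈⟨ +-cong (sym (distribˡ a c (- d)))
                  (+-cong (-‿distribˡ-* b c)
                          (trans (sym (-‿involutive _))
                            (trans (-‿cong (-‿distribˡ-* b d)) (-‿distribʳ-* (- b) d)))) ⟩
      a * (c + - d) + (- b * c + - b * - d)
        ≈⟨ +-congˡ (sym (distribˡ (- b) c (- d))) ⟩
      a * (c + - d) + - b * (c + - d)
        ≈⟨ sym (distribʳ _ _ _) ⟩
      (a + - b) * (c + - d) ∎
      where
      a = value m ; b = value n ; c = value m′ ; d = value n′
      values : ∀ i j k l → value (i ℕ.* j ℕ.+ k ℕ.* l) ≈ value i * value j + value k * value l
      values i j k l = trans (×-homo-+ 1# (i ℕ.* j) (k ℕ.* l)) (+-cong (×1-homo-* i j) (×1-homo-* k l))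

    morphism : Coefficient -Raw-AlmostCommutative⟶ fromCommutativeRing commutativeRing
    morphism = record
      { ⟦_⟧ = ⟦_⟧
      ; +-homo = λ p@(m , n) q@(m′ , n′) → trans (⟦reduce⟧ (m ℕ.+ m′ , n ℕ.+ n′))
          (trans (+-cong (×-homo-+ 1# m m′) (-‿cong (×-homo-+ 1# n n′)))
            (trans (interchange⁻ _ _ _ _) (sym (+-cong (⟦⟧≈difference p) (⟦⟧≈difference q)))))
      ; *-homo = λ p@(m , n) q@(m′ , n′) →
        trans (⟦reduce⟧ (m ℕ.* m′ ℕ.+ n ℕ.* n′ , m ℕ.* n′ ℕ.+ n ℕ.* m′))
          (trans (*-homo m n m′ n′) (sym (*-cong (⟦⟧≈difference p) (⟦⟧≈difference q))))
      ; -‿homo = λ p@(m , n) → trans (⟦⟧≈difference (n , m)) (trans (+-comm _ _)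
          (trans (+-congˡ (sym (-‿involutive _)))
            (trans (-‿+-comm (value m) (- value n)) (-‿cong (sym (⟦⟧≈difference p))))))
      ; 0-homo = refl
      ; 1-homo = refl
      }

    equal? : ∀ p q → Maybe (⟦ p ⟧ ≈ ⟦ q ⟧)
    equal? p@(m , n) q@(m′ , n′) =
      Maybe.map (λ eq → trans (⟦⟧≈difference p) (trans (same eq) (sym (⟦⟧≈difference q))))
        (dec⇒weaklyDec ℕ._≟_ (m ℕ.+ n′) (m′ ℕ.+ n))
      where
      same : m ℕ.+ n′ ≡ m′ ℕ.+ n → value m + - value n ≈ value m′ + - value n′
      same eq = +-cancelʳ-≈ (value n + value n′) _ _ (begin
        (value m + - value n) + (value n + value n′)  ≈⟨ cancelled (value m) (value n) (value n′) ⟩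
        value m + value n′                            ≈⟨ sym (×-homo-+ 1# m n′) ⟩
        value (m ℕ.+ n′)                              ≡⟨ ≡.cong value eq ⟩
        value (m′ ℕ.+ n)                              ≈⟨ ×-homo-+ 1# m′ n ⟩
        value m′ + value n                            ≈⟨ sym (cancelled (value m′) (value n′) (value n)) ⟩
        (value m′ + - value n′) + (value n′ + value n) ≈⟨ +-congˡ (+-comm _ _) ⟩
        (value m′ + - value n′) + (value n + value n′) ∎)
        where
        cancelled : ∀ a b c → (a + - b) + (b + c) ≈ a + c
        cancelled a b c = begin
          (a + - b) + (b + c)  ≈⟨ +-assoc _ _ _ ⟩
          a + (- b + (b + c))  ≈⟨ +-congˡ (sym (+-assoc _ _ _)) ⟩
          a + ((- b + b) + c)  ≈⟨ +-congˡ (+-congʳ (-‿inverseˡ b)) ⟩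
          a + (0# + c)         ≈⟨ +-congˡ (+-identityˡ c) ⟩
          a + c                ∎

    open Algebra.Solver.Ring Coefficient (fromCommutativeRing commutativeRing) morphism equal? public
      using (solve; _:+_; _:*_; :-_; _:-_; _:=_; con; Polynomial)

    :0 :1 : ∀ {n} → Polynomial n
    :0 = con (0 , 0)
    :1 = con (1 , 0)

  open IntegerSolver using (solve; _:+_; _:*_; :-_; _:-_; _:=_; :0; :1)

  private module ≤ = IsTotalOrder isTotalOrder

  cancel-+ : ∀ {x y} z → x + z ≈ y + z → x ≈ y
  cancel-+ z = +-cancelʳ-≈ z _ _

  zero? : ∀ x → Dec (x ≈ 0#)
  zero? x = em

  *-nonzero : ∀ {x y} → ¬ (x ≈ 0#) → x * y ≈ 0# → y ≈ 0#
  *-nonzero {x} {y} x≉0 xy≈0 = begin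
    y            ≈⟨ sym (*-identityˡ y) ⟩
    1# * y       ≈⟨ *-congʳ (sym xi≈1) ⟩
    (x * i) * y  ≈⟨ solve 3 (λ x y i → (x :* i) :* y := i :* (x :* y)) refl x y i ⟩
    i * (x * y)  ≈⟨ *-congˡ xy≈0 ⟩
    i * 0#       ≈⟨ zeroʳ i ⟩
    0#           ∎
    where
    i = proj₁ (inverse x x≉0)
    xi≈1 = proj₂ (inverse x x≉0)

  NonNeg Positive : Carrier → Set
  NonNeg x = 0# ≤ x
  Positive x = NonNeg x × ¬ (x ≈ 0#)

  nonNeg-resp : ∀ {x y} → x ≈ y → NonNeg x → NonNeg y
  nonNeg-resp eq 0≤x = ≤.trans 0≤x (≤.reflexive eq)

  nonNeg-or-neg : ∀ x → NonNeg x ⊎ NonNeg (- x)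
  nonNeg-or-neg x with ≤.total 0# x
  ... | inj₁ 0≤x = inj₁ 0≤x
  ... | inj₂ x≤0 = inj₂ (nonNeg-resp (+-identityˡ _)
                     (≤.trans (≤.reflexive (sym (-‿inverseʳ x))) (+-monoˡ-≤ (- x) x≤0)))

  nonNeg-+ : ∀ {x y} → NonNeg x → NonNeg y → NonNeg (x + y)
  nonNeg-+ {x} {y} 0≤x 0≤y =
    ≤.trans 0≤y (≤.trans (≤.reflexive (sym (+-identityˡ y))) (+-monoˡ-≤ y 0≤x))

  nonNeg-antisym : ∀ {x} → NonNeg x → NonNeg (- x) → x ≈ 0#
  nonNeg-antisym {x} p q = ≤.antisym
    (≤.trans (≤.reflexive (sym (+-identityˡ x)))
      (≤.trans (+-monoˡ-≤ x q) (≤.reflexive (-‿inverseˡ x)))) p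

  positive-1 : Positive 1#
  positive-1 with nonNeg-or-neg 1#
  ... | inj₁ p = p , 1≉0
  ... | inj₂ p = nonNeg-resp (solve 0 ((:- :1) :* (:- :1) := :1) refl) (*-nonNeg p p) , 1≉0

  positive-+ : ∀ {x y} → Positive x → NonNeg y → Positive (x + y)
  positive-+ {x} {y} (p , q) r = nonNeg-+ p r , λ x+y≈0 →
    q (nonNeg-antisym p (nonNeg-resp
        (trans (solve 2 (λ x y → y := (x :+ y) :- x) refl x y)
               (trans (+-congʳ x+y≈0) (+-identityˡ _))) r))

  positive-* : ∀ {x y} → Positive x → Positive y → Positive (x * y)
  positive-* (p , q) (r , s) = *-nonNeg p r , λ xy≈0 → s (*-nonzero q xy≈0)

  positive-inverse : ∀ {x y} → Positive x → x * y ≈ 1# → Positive y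
  positive-inverse {x} {y} (p , q) xy≈1 =
    nonNeg , λ y≈0 → 1≉0 (trans (sym xy≈1) (trans (*-congˡ y≈0) (zeroʳ x)))
    where
    nonNeg : NonNeg y
    nonNeg with nonNeg-or-neg y
    ... | inj₁ r = r
    ... | inj₂ r = ⊥-elim (1≉0 (nonNeg-antisym (proj₁ positive-1)
            (nonNeg-resp (trans (sym (-‿distribʳ-* x y)) (-‿cong xy≈1)) (*-nonNeg p r))))

  -- Elimination from the leaves to the root

  data Weights : Tree → Set where
    vertex : Carrier → Weights •
    join   : ∀ {t s} → Weights t → (a : Carrier) → ¬ (a ≈ 0#) → Weights s → Weights (t ◁ s)

  -- The indicator function of the root, with real values so that terms occurring only at the root
  -- enter the equations as products.
  δ : ∀ {t} → Vertex t → Carrier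
  δ top       = 1#
  δ (left v)  = δ v
  δ (right v) = 0#

  δ-root : ∀ t → δ (root t) ≈ 1#
  δ-root •       = refl
  δ-root (t ◁ s) = δ-root t

  row : ∀ {t} → Weights t → (Vertex t → Carrier) → Vertex t → Carrier
  row (vertex w) x top = w * x top
  row (join {t} {s} w a _ w′) x (left v)  = row w (x ∘ left) v + δ v * (a * x (right (root s)))
  row (join {t} {s} w a _ w′) x (right v) = row w′ (x ∘ right) v + δ v * (a * x (left (root t)))

  -- (A − λ) x vanishes except possibly at the root, where it is ρ.
  Solution : ∀ {t} → Carrier → Weights t → (Vertex t → Carrier) → Carrier → Set
  Solution lam w x ρ = ∀ v → row w x v ≈ lam * x v + δ v * ρ

  -- The pivot left at the root by eliminating all other vertices bottom-up; it is
  -- ∞ if the root has been paired with a child whose pivot vanishes.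
  data Pivot : Set where
    fin : Carrier → Pivot
    ∞   : Pivot

  -- With the convention 1/∞ = 0, a child of pivot ∞ leaves the pivot of its parent unchanged in
  -- `schur`.
  Reciprocal : Pivot → Carrier → Set
  Reciprocal (fin d) u = d * u ≈ 1#
  Reciprocal ∞       u = u ≈ 0#

  Vanishes : Pivot → Set
  Vanishes (fin d) = d ≈ 0#
  Vanishes ∞       = ⊥

  vanishes-or-reciprocal : ∀ σ → Vanishes σ ⊎ ∃ (Reciprocal σ)
  vanishes-or-reciprocal ∞ = inj₂ (0# , refl)
  vanishes-or-reciprocal (fin d) with zero? d
  ... | yes d≈0 = inj₁ d≈0
  ... | no  d≉0 = inj₂ (inverse d d≉0)

  -- The number counts the children with vanishing pivot in excess of the one that
  -- the parent is paired with; each such child contributes a kernel vector.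
  data Elim (lam : Carrier) : ∀ {t} → Weights t → ℕ → Pivot → Set where
    leaf  : ∀ {w d} → d + lam ≈ w → Elim lam (vertex w) 0 (fin d)
    schur : ∀ {t s} {w : Weights t} {w′ : Weights s} {a a≉0 n n′ e σ u e′} →
            Elim lam w n (fin e) → Elim lam w′ n′ σ → Reciprocal σ u →
            e′ + a * a * u ≈ e →
            Elim lam (join w a a≉0 w′) (n ℕ.+ n′) (fin e′)
    keep  : ∀ {t s} {w : Weights t} {w′ : Weights s} {a a≉0 n n′ σ u} →
            Elim lam w n ∞ → Elim lam w′ n′ σ → Reciprocal σ u →
            Elim lam (join w a a≉0 w′) (n ℕ.+ n′) ∞
    kill  : ∀ {t s} {w : Weights t} {w′ : Weights s} {a a≉0 n n′ e d} →
            Elim lam w n (fin e) → Elim lam w′ n′ (fin d) → d ≈ 0# →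
            Elim lam (join w a a≉0 w′) (n ℕ.+ n′) ∞
    gain  : ∀ {t s} {w : Weights t} {w′ : Weights s} {a a≉0 n n′ d} →
            Elim lam w n ∞ → Elim lam w′ n′ (fin d) → d ≈ 0# →
            Elim lam (join w a a≉0 w′) (suc (n ℕ.+ n′)) ∞

  -- `Elim` only relates weights and pivots by equations, so that weights can later be solved for
  -- when pivots are prescribed; here the equations are solved for the pivots.
  eliminate : ∀ lam {t} (w : Weights t) → ∃[ n ] ∃[ σ ] Elim lam w n σ
  eliminate lam (vertex w) = 0 , fin (w + - lam) ,
    leaf (solve 2 (λ w l → (w :- l) :+ l := w) refl w lam)
  eliminate lam (join w a _ w′) with eliminate lam w | eliminate lam w′
  ... | n , σ , D | n′ , σ′ , E with vanishes-or-reciprocal σ′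
  eliminate lam (join w a _ w′) | n , fin e , D | n′ , σ′ , E | inj₂ (u , r) =
    _ , _ , schur D E r (solve 2 (λ e p → (e :- p) :+ p := e) refl e (a * a * u))
  eliminate lam (join w a _ w′) | n , ∞ , D | n′ , σ′ , E | inj₂ (u , r) = _ , _ , keep D E r
  eliminate lam (join w a _ w′) | n , fin e , D | n′ , fin d , E | inj₁ z = _ , _ , kill D E z
  eliminate lam (join w a _ w′) | n , ∞ , D | n′ , fin d , E | inj₁ z = _ , _ , gain D E z

  -- Solutions parametrised by an elimination.

  module _ {lam : Carrier} where

    -- Cutting the joining edge moves the term that came through it into the residual at the root of
    -- each side.
    Solution-left : ∀ {t s} {w : Weights t} {w′ : Weights s} {a a≉0 x ρ} →
      Solution lam (join w a a≉0 w′) x ρ →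
      Solution lam w (x ∘ left) (ρ + - (a * x (right (root s))))
    Solution-left {s = s} {w} {w′} {a} {a≉0} {x} {ρ} S v = cancel-+ (δ v * y) (begin
      row w (x ∘ left) v + δ v * y            ≈⟨ S (left v) ⟩
      lam * x (left v) + δ v * ρ
        ≈⟨ solve 4 (λ l d r y → l :+ d :* r := (l :+ d :* (r :- y)) :+ d :* y) refl _ _ _ _ ⟩
      (lam * x (left v) + δ v * (ρ + - y)) + δ v * y ∎)
      where y = a * x (right (root s))

    Solution-right : ∀ {t s} {w : Weights t} {w′ : Weights s} {a a≉0 x ρ} →
      Solution lam (join w a a≉0 w′) x ρ →
      Solution lam w′ (x ∘ right) (- (a * x (left (root t))))
    Solution-right {t} {w = w} {w′} {a} {a≉0} {x} {ρ} S v = cancel-+ (δ v * y) (begin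
      row w′ (x ∘ right) v + δ v * y          ≈⟨ S (right v) ⟩
      lam * x (right v) + 0# * ρ
        ≈⟨ solve 4 (λ l d r y → l :+ :0 :* r := (l :+ d :* (:- y)) :+ d :* y) refl _ (δ v) ρ y ⟩
      (lam * x (right v) + δ v * - y) + δ v * y ∎)
      where y = a * x (left (root t))

    Solution-resp : ∀ {t} {w : Weights t} {x ρ ρ′} → ρ ≈ ρ′ → Solution lam w x ρ → Solution lam w x ρ′
    Solution-resp eq S v = trans (S v) (+-congˡ (*-congˡ eq))

    glue : ∀ {t s} → (Vertex t → Carrier) → (Vertex s → Carrier) → Vertex (t ◁ s) → Carrier
    glue x y (left v)  = x v
    glue x y (right v) = y v

    Solution-glue : ∀ {t s} {w : Weights t} {w′ : Weights s} {a a≉0 x y ρ ρ₁ ρ₂} →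
      Solution lam w x ρ₁ → Solution lam w′ y ρ₂ →
      ρ₁ + a * y (root s) ≈ ρ → ρ₂ + a * x (root t) ≈ 0# →
      Solution lam (join w a a≉0 w′) (glue x y) ρ
    Solution-glue {t} {s} {w} {w′} {a} {x = x} {y} {ρ} {ρ₁} S R p q (left v) = begin
      row w x v + δ v * (a * y (root s))             ≈⟨ +-congʳ (S v) ⟩
      (lam * x v + δ v * ρ₁) + δ v * (a * y (root s))
        ≈⟨ solve 4 (λ l d r y → (l :+ d :* r) :+ d :* y := l :+ d :* (r :+ y)) refl _ _ _ _ ⟩
      lam * x v + δ v * (ρ₁ + a * y (root s))        ≈⟨ +-congˡ (*-congˡ p) ⟩
      lam * x v + δ v * ρ                            ∎
    Solution-glue {t} {s} {w} {w′} {a} {x = x} {y} {ρ} {ρ₂ = ρ₂} S R p q (right v) = begin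
      row w′ y v + δ v * (a * x (root t))            ≈⟨ +-congʳ (R v) ⟩
      (lam * y v + δ v * ρ₂) + δ v * (a * x (root t))
        ≈⟨ solve 4 (λ l d r y → (l :+ d :* r) :+ d :* y := l :+ d :* (r :+ y)) refl _ _ _ _ ⟩
      lam * y v + δ v * (ρ₂ + a * x (root t))        ≈⟨ +-congˡ (*-congˡ q) ⟩
      lam * y v + δ v * 0#                           ≈⟨ solve 3 (λ l d r → l :+ d :* :0 := l :+ :0 :* r) refl _ _ ρ ⟩
      lam * y v + 0# * ρ                             ∎

    -- The relation that elimination imposes between the value r at the root and
    -- the residual ρ there.
    Related : Pivot → Carrier → Carrier → Set
    Related (fin d) r ρ = ρ ≈ d * r
    Related ∞       r ρ = r ≈ 0#

    -- `Related` describes a line in the plane of pairs (r, ρ); this is a coordinate on it.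
    lead : Pivot → Carrier → Carrier → Carrier
    lead (fin d) r ρ = r
    lead ∞       r ρ = ρ

    value-of-residual : ∀ σ {u r ρ} → Reciprocal σ u → Related σ r ρ → r ≈ u * ρ
    value-of-residual (fin d) {u} {r} {ρ} du≈1 ρ≈dr = begin
      r            ≈⟨ sym (*-identityˡ r) ⟩
      1# * r       ≈⟨ *-congʳ (sym du≈1) ⟩
      (d * u) * r  ≈⟨ solve 3 (λ d u r → (d :* u) :* r := u :* (d :* r)) refl d u r ⟩
      u * (d * r)  ≈⟨ *-congˡ (sym ρ≈dr) ⟩
      u * ρ        ∎
    value-of-residual ∞ u≈0 r≈0 = trans r≈0 (sym (trans (*-congʳ u≈0) (zeroˡ _)))

    -- For `schur`, the child's value is u times its residual -az, where z is the value at the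
    -- parent, so the child contributes -a²uz. For `kill`, the child's residual -az is d times its
    -- value, hence 0, which forces z = 0.
    related : ∀ {t} {w : Weights t} {n σ x ρ} → Elim lam w n σ → Solution lam w x ρ → Related σ (x (root t)) ρ
    related {x = x} {ρ} (leaf {w} {d} p) S = cancel-+ (lam * x top) (begin
      ρ + lam * x top          ≈⟨ solve 3 (λ r l x → r :+ l :* x := l :* x :+ :1 :* r) refl ρ lam (x top) ⟩
      lam * x top + 1# * ρ     ≈⟨ sym (S top) ⟩
      w * x top                ≈⟨ *-congʳ (sym p) ⟩
      (d + lam) * x top        ≈⟨ distribʳ _ _ _ ⟩
      d * x top + lam * x top  ∎)
    related {x = x} {ρ} (schur {t} {s} {w = w} {w′} {a = a} {e = e} {σ} {u} {e′} D E r p) S = begin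
      ρ                                ≈⟨ solve 2 (λ ρ y → ρ := (ρ :- y) :+ y) refl ρ (a * y) ⟩
      (ρ + - (a * y)) + a * y          ≈⟨ +-cong (related D (Solution-left S))
                                            (*-congˡ (value-of-residual σ r (related E (Solution-right {w = w} S)))) ⟩
      e * z + a * (u * - (a * z))      ≈⟨ +-congʳ (*-congʳ (sym p)) ⟩
      (e′ + a * a * u) * z + a * (u * - (a * z))
        ≈⟨ solve 4 (λ e a u z → (e :+ a :* a :* u) :* z :+ a :* (u :* (:- (a :* z))) := e :* z) refl e′ a u z ⟩
      e′ * z                           ∎
      where
      y = x (right (root s))
      z = x (left (root t))
    related (keep D E r) S = related D (Solution-left S)
    related {x = x} (kill {t} {w = w} {a = a} {a≉0} {d = d} D E d≈0) S = *-nonzero a≉0 (begin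
      a * z              ≈⟨ solve 1 (λ y → y := :- (:- y)) refl (a * z) ⟩
      - (- (a * z))      ≈⟨ -‿cong (related E (Solution-right {w = w} S)) ⟩
      - (d * _)          ≈⟨ -‿cong (*-congʳ d≈0) ⟩
      - (0# * _)         ≈⟨ solve 1 (λ y → :- (:0 :* y) := :0) refl _ ⟩
      0#                 ∎)
      where z = x (left (root t))
    related (gain D E d≈0) S = related D (Solution-left S)

    -- One index for each `gain`; `at` is the vertex where that parameter is read off. Together with
    -- `lead` these are coordinates on the solutions: they determine a solution by `determined` and
    -- take arbitrary values by `extend`.
    Free : ∀ {t} {w : Weights t} {n σ} → Elim lam w n σ → Set
    Free (leaf _)        = ⊥
    Free (schur D E _ _) = Free D ⊎ Free E
    Free (keep D E _)    = Free D ⊎ Free E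
    Free (kill D E _)    = Free D ⊎ Free E
    Free (gain D E _)    = Maybe (Free D ⊎ Free E)

    at : ∀ {t} {w : Weights t} {n σ} (D : Elim lam w n σ) → Free D → Vertex t
    at (schur D E _ _) = [ left ∘ at D , right ∘ at E ]′
    at (keep D E _)    = [ left ∘ at D , right ∘ at E ]′
    at (kill D E _)    = [ left ∘ at D , right ∘ at E ]′
    at (gain D E _) nothing         = right (root _)
    at (gain D E _) (just (inj₁ i)) = left (at D i)
    at (gain D E _) (just (inj₂ i)) = right (at E i)

  module _ {lam : Carrier} where

    lead-zero : ∀ σ {u r ρ} → Reciprocal σ u → Related {lam} σ r ρ → ρ ≈ 0# → lead {lam} σ r ρ ≈ 0#
    lead-zero (fin d) du≈1 rel ρ≈0 =
      trans (value-of-residual {lam} (fin d) du≈1 rel) (trans (*-congˡ ρ≈0) (zeroʳ _))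
    lead-zero ∞ _ _ ρ≈0 = ρ≈0

    residual-zero : ∀ {a y} → y ≈ 0# → - (a * y) ≈ 0#
    residual-zero {a} y≈0 = trans (-‿cong (*-congˡ y≈0)) (solve 1 (λ a → :- (a :* :0) := :0) refl a)

    residual-same : ∀ {ρ a y} → ρ ≈ 0# → y ≈ 0# → ρ + - (a * y) ≈ 0#
    residual-same ρ≈0 y≈0 = trans (+-cong ρ≈0 (residual-zero y≈0)) (+-identityˡ 0#)

    glue-zero : ∀ {t s} {x : Vertex (t ◁ s) → Carrier} →
      (∀ v → x (left v) ≈ 0#) → (∀ v → x (right v) ≈ 0#) → ∀ v → x v ≈ 0#
    glue-zero p q (left v)  = p v
    glue-zero p q (right v) = q v

    determined : ∀ {t} {w : Weights t} {n σ x ρ} (D : Elim lam w n σ) → Solution lam w x ρ →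
      (∀ i → x (at D i) ≈ 0#) → lead {lam} σ (x (root t)) ρ ≈ 0# → ∀ v → x v ≈ 0#
    determined (leaf _) S free z top = z
    determined {x = x} (schur {t} {w = w} {σ = σ} D E r p) S free z =
      glue-zero (determined D (Solution-left S) (free ∘ inj₁) z)
        (determined E S′ (free ∘ inj₂) (lead-zero σ r (related E S′) (residual-zero z)))
      where S′ = Solution-right {w = w} S
    determined {x = x} {ρ} (keep {t} {w = w} {σ = σ} D E r) S free z =
      glue-zero (determined D (Solution-left S) (free ∘ inj₁) (residual-same z (x≈0 _)))
        x≈0
      where
      S′ = Solution-right {w = w} S
      x≈0 = determined E S′ (free ∘ inj₂)
        (lead-zero σ r (related E S′) (residual-zero (related D (Solution-left S))))
    -- The value at the parent is 0, so the residual that its finite pivot leaves is 0 too; hence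
    -- `a * y` equals `ρ`, which is the lead and vanishes.
    determined {x = x} {ρ} (kill {t} {s} {w = w} {a = a} {a≉0} {e = e} {d} D E d≈0) S free z =
      glue-zero x≈0 (determined E (Solution-right {w = w} S) (free ∘ inj₂)
        (*-nonzero a≉0 (begin
          a * y                    ≈⟨ solve 2 (λ y r → y := r :- (r :- y)) refl (a * y) ρ ⟩
          ρ + - (ρ + - (a * y))    ≈⟨ +-cong z (-‿cong (related D (Solution-left S))) ⟩
          0# + - (e * x (left (root t))) ≈⟨ +-congˡ (residual-zero (x≈0 (root t))) ⟩
          0# + 0#                  ≈⟨ +-identityˡ 0# ⟩
          0#                       ∎)))
      where
      y = x (right (root s))
      x≈0 = determined D (Solution-left S) (free ∘ inj₁)
        (related (kill {a≉0 = a≉0} D E d≈0) S)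
    determined {x = x} (gain {w = w} D E d≈0) S free z =
      glue-zero (determined D (Solution-left S) (free ∘ just ∘ inj₁) (residual-same z (free nothing)))
        (determined E (Solution-right {w = w} S) (free ∘ just ∘ inj₂) (free nothing))

    record Extension {t} {w : Weights t} {n σ} (D : Elim lam w n σ) (f : Free D → Carrier) (c : Carrier) : Set where
      constructor extension
      field
        {vector}   : Vertex t → Carrier
        {residual} : Carrier
        solution   : Solution lam w vector residual
        leading    : lead {lam} σ (vector (root t)) residual ≈ c
        free       : ∀ i → vector (at D i) ≈ f i

    open Extension

    -- If the pivot does not vanish, lead and residual determine each other, so the residual may be
    -- prescribed in place of the lead.
    extend-residual : ∀ {t} {w : Weights t} {n σ u} (D : Elim lam w n σ) → Reciprocal σ u →
      (f : Free D → Carrier) (ρ : Carrier) → (∀ c → Extension D f c) →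
      ∃[ x ] Solution lam w x ρ × ∀ i → x (at D i) ≈ f i
    extend-residual {w = w} {σ = fin d} {u} D r f ρ ext with ext (u * ρ)
    ... | extension {x} {ρ′} S l fr = x , Solution-resp {w = w} eq S , fr
      where
      eq : ρ′ ≈ ρ
      eq = begin
        ρ′           ≈⟨ related D S ⟩
        d * x (root _) ≈⟨ *-congˡ l ⟩
        d * (u * ρ)  ≈⟨ sym (*-assoc d u ρ) ⟩
        (d * u) * ρ  ≈⟨ *-congʳ r ⟩
        1# * ρ       ≈⟨ *-identityˡ ρ ⟩
        ρ            ∎
    extend-residual {w = w} {σ = ∞} D r f ρ ext with ext ρ
    ... | extension {x} S l fr = x , Solution-resp {w = w} l S , fr

    extend : ∀ {t} {w : Weights t} {n σ} (D : Elim lam w n σ) f c → Extension D f c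
    extend (leaf {w} {d} p) f c = extension {vector = λ _ → c} {residual = d * c}
      (λ { top → trans (*-congʳ (sym p))
        (solve 3 (λ d l c → (d :+ l) :* c := l :* c :+ :1 :* (d :* c)) refl d lam c) })
      refl (λ ())
    extend (schur {t} {s} {a = a} {a≉0} D E r p) f c with extend D (f ∘ inj₁) c
    ... | extension {x} {ρ} S l fr
      with extend-residual E r (f ∘ inj₂) (- (a * x (root t))) (extend E (f ∘ inj₂))
    ... | y , R , fr′ = extension (Solution-glue {a≉0 = a≉0} S R refl (-‿inverseˡ _)) l
      λ { (inj₁ i) → fr i ; (inj₂ i) → fr′ i }
    extend (keep {t} {s} {a = a} {a≉0} D E r) f c
      with extend-residual E r (f ∘ inj₂) 0# (extend E (f ∘ inj₂))
    ... | y , R , fr′ with extend D (f ∘ inj₁) (c + - (a * y (root s)))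
    ... | extension {x} {ρ} S l fr = extension
      (Solution-glue {a≉0 = a≉0} S R
        (trans (+-congʳ l) (solve 2 (λ c y → (c :- y) :+ y := c) refl c (a * y (root s))))
        (trans (+-identityˡ _) (trans (*-congˡ (related D S)) (zeroʳ a))))
      refl λ { (inj₁ i) → fr i ; (inj₂ i) → fr′ i }
    -- The lead 0 on the left puts the value 0 at the parent; the child's value c/a then creates the
    -- required residual c.
    extend (kill {t} {s} {a = a} {a≉0} {e = e} {d} D E d≈0) f c
      with extend D (f ∘ inj₁) 0# | extend E (f ∘ inj₂) (proj₁ (inverse a a≉0) * c)
    ... | extension {x} {ρ} S l fr | extension {y} {ρ′} R l′ fr′ = extension
      (Solution-glue {a≉0 = a≉0} S R
        (begin
          ρ + a * y (root s)            ≈⟨ +-cong (related D S) (*-congˡ l′) ⟩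
          e * x (root t) + a * (i * c)  ≈⟨ +-cong (trans (*-congˡ l) (zeroʳ e)) (sym (*-assoc a i c)) ⟩
          0# + (a * i) * c              ≈⟨ +-congˡ (*-congʳ (proj₂ (inverse a a≉0))) ⟩
          0# + 1# * c                   ≈⟨ solve 1 (λ c → :0 :+ :1 :* c := c) refl c ⟩
          c                             ∎)
        (begin
          ρ′ + a * x (root t)           ≈⟨ +-cong (related E R) (*-congˡ l) ⟩
          d * y (root s) + a * 0#       ≈⟨ +-congʳ (*-congʳ d≈0) ⟩
          0# * y (root s) + a * 0#      ≈⟨ solve 2 (λ a y → :0 :* y :+ a :* :0 := :0) refl a (y (root s)) ⟩
          0#                            ∎))
      refl λ { (inj₁ i) → fr i ; (inj₂ i) → fr′ i }
      where i = proj₁ (inverse a a≉0)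
    -- The child's value is the new parameter; its effect on the residual is compensated through the
    -- lead of the left part.
    extend (gain {t} {s} {a = a} {a≉0} {d = d} D E d≈0) f c
      with extend E (f ∘ just ∘ inj₂) (f nothing)
    ... | extension {y} {ρ′} R l′ fr′ with extend D (f ∘ just ∘ inj₁) (c + - (a * y (root s)))
    ... | extension {x} {ρ} S l fr = extension
      (Solution-glue {a≉0 = a≉0} S R
        (trans (+-congʳ l) (solve 2 (λ c y → (c :- y) :+ y := c) refl c (a * y (root s))))
        (begin
          ρ′ + a * x (root t)           ≈⟨ +-cong (related E R) (*-congˡ (related D S)) ⟩
          d * y (root s) + a * 0#       ≈⟨ +-congʳ (*-congʳ d≈0) ⟩
          0# * y (root s) + a * 0#      ≈⟨ solve 2 (λ a y → :0 :* y :+ a :* :0 := :0) refl a (y (root s)) ⟩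
          0#                            ∎))
      refl λ { nothing → l′ ; (just (inj₁ i)) → fr i ; (just (inj₂ i)) → fr′ i }

    Maybe↔Fin : ∀ {A : Set} {n} → A ↔ Fin n → Maybe A ↔ Fin (suc n)
    Maybe↔Fin {A} {n} I = mk↔ₛ′ to′ from′ to-from from-to
      where
      open Inverse I
      to′ : Maybe A → Fin (suc n)
      to′ nothing  = zero
      to′ (just i) = suc (to i)
      from′ : Fin (suc n) → Maybe A
      from′ zero    = nothing
      from′ (suc i) = just (from i)
      to-from : ∀ i → to′ (from′ i) ≡ i
      to-from zero    = ≡.refl
      to-from (suc i) = ≡.cong suc (strictlyInverseˡ i)
      from-to : ∀ i → from′ (to′ i) ≡ i
      from-to nothing  = ≡.refl
      from-to (just i) = ≡.cong just (strictlyInverseʳ i)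

    ⊎↔Fin : ∀ {A B : Set} {m n} → A ↔ Fin m → B ↔ Fin n → (A ⊎ B) ↔ Fin (m ℕ.+ n)
    ⊎↔Fin I J = ↔-sym (+↔⊎) ↔-∘ (I ⊎-↔ J)

    Free↔Fin : ∀ {t} {w : Weights t} {n σ} (D : Elim lam w n σ) → Free D ↔ Fin n
    Free↔Fin (leaf _)        = ↔-sym 0↔⊥
    Free↔Fin (schur D E _ _) = ⊎↔Fin (Free↔Fin D) (Free↔Fin E)
    Free↔Fin (keep D E _)    = ⊎↔Fin (Free↔Fin D) (Free↔Fin E)
    Free↔Fin (kill D E _)    = ⊎↔Fin (Free↔Fin D) (Free↔Fin E)
    Free↔Fin (gain D E _)    = Maybe↔Fin (⊎↔Fin (Free↔Fin D) (Free↔Fin E))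

    -- Expresses the dimension of the kernel without choosing a basis; `multiplicity-by-coordinates`
    -- produces one.
    record Coordinates {t} (w : Weights t) (m : ℕ) : Set where
      field
        position : Fin m → Vertex t
        kernel   : ∀ (f : Fin m → Carrier) → ∃[ x ] Solution lam w x 0# × ∀ i → x (position i) ≈ f i
        trivial  : ∀ x → Solution lam w x 0# → (∀ i → x (position i) ≈ 0#) → ∀ v → x v ≈ 0#

    -- With root pivot 0 the residual vanishes whatever the value at the root, so the root is one
    -- more coordinate. With an invertible root pivot, residual 0 forces the lead to be 0 and no
    -- coordinate is added.
    coordinates-zero : ∀ {t} {w : Weights t} {n d} → Elim lam w n (fin d) → d ≈ 0# → Coordinates w (suc n)
    coordinates-zero {t} {w} {n} {d} D d≈0 = record
      { position = position
      ; kernel = λ f → let X = extend D (f ∘ suc ∘ to) (f zero) in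
          vector X
        , Solution-resp {w = w} (trans (related D (solution X)) (trans (*-congʳ d≈0) (zeroˡ _))) (solution X)
        , λ { zero → leading X
            ; (suc i) → trans (free X (from i)) (reflexive (≡.cong (f ∘ suc) (strictlyInverseˡ i))) }
      ; trivial = λ x S z → determined D S
          (λ i → trans (reflexive (≡.cong (x ∘ at D) (≡.sym (strictlyInverseʳ i)))) (z (suc (to i)))) (z zero)
      }
      where
      open Inverse (Free↔Fin D)
      position : Fin (suc n) → Vertex t
      position zero    = root t
      position (suc i) = at D (from i)

    coordinates-nonzero : ∀ {t} {w : Weights t} {n σ u} → Elim lam w n σ → Reciprocal σ u → Coordinates w n
    coordinates-nonzero {t} {w} {n} {σ} D r = record
      { position = at D ∘ from
      ; kernel = λ f → let (x , S , fr) = extend-residual D r (f ∘ to) 0# (extend D (f ∘ to)) in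
          x , S , λ i → trans (fr (from i)) (reflexive (≡.cong f (strictlyInverseˡ i)))
      ; trivial = λ x S z → determined D S
          (λ i → trans (reflexive (≡.cong (x ∘ at D) (≡.sym (strictlyInverseʳ i)))) (z (to i)))
          (lead-zero σ r (related D S) refl)
      }
      where open Inverse (Free↔Fin D)

    Nullity : ∀ {t} → Weights t → ℕ → Set
    Nullity w m = ∃[ σ ]
      ((Elim lam w m σ × ∃ (Reciprocal σ)) ⊎ (∃[ n ] Elim lam w n σ × Vanishes σ × m ≡ suc n))

    coordinates : ∀ {t} {w : Weights t} {m} → Nullity w m → Coordinates w m
    coordinates (σ , inj₁ (D , _ , r)) = coordinates-nonzero D r
    coordinates (fin d , inj₂ (n , D , z , ≡.refl)) = coordinates-zero D z

  -- Prescribing pivots at two eigenvalues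

  record Pair (t : Tree) (m : ℕ) (σ : Pivot) (b : ℕ) (τ : Pivot) : Set where
    constructor pair
    field
      {weights} : Weights t
      at0       : Elim 0# weights m σ
      at-1      : Elim (- 1#) weights b τ

  -- The modes in which a tree can be realised with m excess vanishing pivots at
  -- the eigenvalue 0 and b at −1.  The letters give the pivot of the root at 0 and
  -- at −1: F for a finite pivot, I for ∞.  The gap between two finite pivots
  -- cannot be prescribed, except in a tunable tree, where it can be made ≤ 0.
  FF IF FI II Tunable : Tree → ℕ → ℕ → Set
  FF t m b = ∃[ g ] Positive g × ∀ x → Pair t m (fin x) b (fin (x + g))
  IF t m b = ∀ y → Pair t m ∞ b (fin y)
  FI t m b = ∀ x → Pair t m (fin x) b ∞
  II t m b = Pair t m ∞ b ∞
  Tunable t m b = ∀ y d → NonNeg d → Pair t m (fin (y + d)) b (fin y)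

  -- How a child enters the elimination of its parent: N for a nonvanishing pivot,
  -- Z for a vanishing one, again at 0 and at −1.
  NN ZN NZ ZZ Steep : Tree → ℕ → ℕ → Set
  NN s m b = ∃[ σ ] ∃[ τ ] ∃[ u′ ] ∃[ d ]
    Pair s m σ b τ × Reciprocal σ (u′ + d) × Reciprocal τ u′ × NonNeg d
  ZN s m b = ∃[ τ ] Pair s m (fin 0#) b τ × ∃ (Reciprocal τ)
  NZ s m b = ∃[ σ ] ∃[ y ] Pair s m σ b (fin y) × y ≈ 0# × ∃ (Reciprocal σ)
  ZZ s m b = ∃[ x ] Pair s m (fin x) b (fin 0#) × x ≈ 0#
  Steep s m b = ∀ K → Positive K → ∃[ a ] ¬ (a ≈ 0#) × ∃[ σ ] ∃[ τ ] ∃[ u ] ∃[ u′ ]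
    Pair s m σ b τ × Reciprocal σ u × Reciprocal τ u′ × a * a * u + K ≈ a * a * u′

  -- The gap at a leaf is the distance between the two eigenvalues.
  FF-leaf : FF • 0 0
  FF-leaf = 1# , positive-1 , λ x → pair (leaf refl)
    (leaf (solve 1 (λ x → (x :+ :1) :+ :- :1 := x :+ :0) refl x))

  -- The pivots 1 and 1 + g are positive, so their reciprocals are ordered the other way. `NN`
  -- demands this order because the difference of the reciprocals is added to the parent's gap in
  -- `FF·NN`.
  FF⇒NN : ∀ {s m b} → FF s m b → NN s m b
  FF⇒NN (g , g>0 , P) = _ , _ , u , g * u , P 1# , one , u≈ , proj₁ (positive-* g>0 u>0)
    where
    1+g>0 = positive-+ positive-1 (proj₁ g>0)
    u = proj₁ (inverse (1# + g) (proj₂ 1+g>0))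
    u≈ = proj₂ (inverse (1# + g) (proj₂ 1+g>0))
    u>0 = positive-inverse 1+g>0 u≈
    one : 1# * (u + g * u) ≈ 1#
    one = trans (solve 2 (λ g u → :1 :* (u :+ g :* u) := (:1 :+ g) :* u) refl g u) u≈

  FF⇒ZN : ∀ {s m b} → FF s m b → ZN s m b
  FF⇒ZN (g , g>0 , P) = _ , P 0# , proj₁ i , trans (*-congʳ (+-identityˡ g)) (proj₂ i)
    where i = inverse g (proj₂ g>0)

  FF⇒NZ : ∀ {s m b} → FF s m b → NZ s m b
  FF⇒NZ (g , g>0 , P) = _ , _ , P (- g) , -‿inverseˡ g , - proj₁ i ,
      trans (solve 2 (λ g i → (:- g) :* (:- i) := g :* i) refl g (proj₁ i)) (proj₂ i)
    where i = inverse g (proj₂ g>0)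

  -- With i = 1/(1 + Kg), the pivots −gKgi and gi differ by g, and a = Kgi gives
  -- a²/(gi) + a²/(gKgi) = K.
  FF⇒Steep : ∀ {s m b} → FF s m b → Steep s m b
  FF⇒Steep (g , g>0 , P) K K>0 =
    a , a≉0 , _ , _ , - (h * (h * k) * D) , h * D , P (- (g * a)) , recip-σ , recip-τ , eq
    where
    D>0 : Positive (1# + K * g)
    D>0 = positive-+ positive-1 (proj₁ (positive-* K>0 g>0))
    D i h k a : Carrier
    D = 1# + K * g
    i = proj₁ (inverse D (proj₂ D>0))
    h = proj₁ (inverse g (proj₂ g>0))
    k = proj₁ (inverse K (proj₂ K>0))
    a = K * g * i
    Di : D * i ≈ 1#
    Di = proj₂ (inverse D (proj₂ D>0))
    gh : g * h ≈ 1#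
    gh = proj₂ (inverse g (proj₂ g>0))
    Kk : K * k ≈ 1#
    Kk = proj₂ (inverse K (proj₂ K>0))
    a≉0 : ¬ (a ≈ 0#)
    a≉0 = proj₂ (positive-* (positive-* K>0 g>0) (positive-inverse D>0 Di))
    recip-σ : - (g * a) * - (h * (h * k) * D) ≈ 1#
    recip-σ = begin
      - (g * a) * - (h * (h * k) * D)
        ≈⟨ solve 6 (λ g K i h k D → (:- (g :* (K :* g :* i))) :* (:- (h :* (h :* k) :* D))
                    := (g :* h) :* (g :* h) :* (K :* k) :* (D :* i)) refl g K i h k D ⟩
      (g * h) * (g * h) * (K * k) * (D * i)
        ≈⟨ *-cong (*-cong (*-cong gh gh) Kk) Di ⟩
      1# * 1# * 1# * 1#  ≈⟨ solve 0 (:1 :* :1 :* :1 :* :1 := :1) refl ⟩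
      1# ∎
    recip-τ : (- (g * a) + g) * (h * D) ≈ 1#
    recip-τ = begin
      (- (g * a) + g) * (h * D)
        ≈⟨ *-congʳ (begin
            - (g * a) + g                            ≈⟨ +-congˡ (sym (*-identityʳ g)) ⟩
            - (g * a) + g * 1#                       ≈⟨ +-congˡ (*-congˡ (sym Di)) ⟩
            - (g * a) + g * (D * i)
              ≈⟨ solve 3 (λ g K i → (:- (g :* (K :* g :* i))) :+ g :* ((:1 :+ K :* g) :* i) := g :* i) refl g K i ⟩
            g * i                                    ∎) ⟩
      (g * i) * (h * D)      ≈⟨ solve 4 (λ g i h D → (g :* i) :* (h :* D) := (g :* h) :* (D :* i)) refl g i h D ⟩
      (g * h) * (D * i)      ≈⟨ *-cong gh Di ⟩
      1# * 1#                ≈⟨ *-identityˡ 1# ⟩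
      1#                     ∎
    eq : a * a * - (h * (h * k) * D) + K ≈ a * a * (h * D)
    eq = begin
      a * a * - (h * (h * k) * D) + K
        ≈⟨ +-congʳ (solve 6 (λ g K i h k D → (K :* g :* i) :* (K :* g :* i) :* (:- (h :* (h :* k) :* D))
              := :- ((g :* h) :* (g :* h) :* (K :* k) :* (D :* i) :* (K :* i))) refl g K i h k D) ⟩
      - ((g * h) * (g * h) * (K * k) * (D * i) * (K * i)) + K
        ≈⟨ +-cong (-‿cong (*-congʳ (*-cong (*-cong (*-cong gh gh) Kk) Di)))
                  (trans (sym (*-identityʳ K)) (*-congˡ (sym Di))) ⟩
      - (1# * 1# * 1# * 1# * (K * i)) + K * (D * i)
        ≈⟨ solve 3 (λ K g i → :- (:1 :* :1 :* :1 :* :1 :* (K :* i)) :+ K :* ((:1 :+ K :* g) :* i)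
              := :1 :* :1 :* (K :* (K :* g) :* i)) refl K g i ⟩
      1# * 1# * (K * (K * g) * i)
        ≈⟨ *-congʳ (sym (*-cong gh Di)) ⟩
      (g * h) * (D * i) * (K * (K * g) * i)
        ≈⟨ solve 5 (λ g K i h D → (g :* h) :* (D :* i) :* (K :* (K :* g) :* i)
              := (K :* g :* i) :* (K :* g :* i) :* (h :* D)) refl g K i h D ⟩
      a * a * (h * D) ∎

  IF⇒NN : ∀ {s m b} → IF s m b → NN s m b
  -- The pivot -1 has the reciprocal -1, which lies below the reciprocal 0 of ∞.
  IF⇒NN P = _ , _ , - 1# , 1# , P (- 1#) , -‿inverseˡ 1# ,
    solve 0 ((:- :1) :* (:- :1) := :1) refl , proj₁ positive-1

  IF⇒NZ : ∀ {s m b} → IF s m b → NZ s m b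
  IF⇒NZ P = _ , _ , P 0# , refl , 0# , refl

  IF⇒Steep : ∀ {s m b} → IF s m b → Steep s m b
  IF⇒Steep P K (_ , K≉0) = 1# , 1≉0 , _ , _ , 0# , K , P (proj₁ i) , refl , trans (*-comm _ _) (proj₂ i) ,
    solve 1 (λ K → :1 :* :1 :* :0 :+ K := :1 :* :1 :* K) refl K
    where i = inverse K K≉0

  FI⇒NN : ∀ {s m b} → FI s m b → NN s m b
  FI⇒NN P = _ , _ , 0# , 1# , P 1# , trans (*-identityˡ _) (+-identityˡ 1#) , refl , proj₁ positive-1

  II⇒NN : ∀ {s m b} → II s m b → NN s m b
  II⇒NN P = _ , _ , 0# , 0# , P , +-identityˡ 0# , refl , IsTotalOrder.refl isTotalOrder

  Tunable⇒ZZ : ∀ {s m b} → Tunable s m b → ZZ s m b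
  Tunable⇒ZZ P = _ , P 0# 0# (IsTotalOrder.refl isTotalOrder) , +-identityˡ 0#

  -- Attaching a branch at two eigenvalues at once.

  module _ {t s : Tree} {m b m′ b′ : ℕ} where

    private
      -- Every edge attached in this module gets the weight 1, except in `FF·Steep`, where the
      -- weight does the tuning.
      unit : ∀ {e u d} → e + u ≈ d → e + 1# * 1# * u ≈ d
      unit {e} {u} = trans (solve 2 (λ e u → e :+ :1 :* :1 :* u := e :+ u) refl e u)

    FF·NN : FF t m b → NN s m′ b′ → FF (t ◁ s) (m ℕ.+ m′) (b ℕ.+ b′)
    FF·NN (g , g>0 , P) (σ , τ , u′ , d , Q , rσ , rτ , d≥0) = g + d , positive-+ g>0 d≥0 , λ x →
      let pair D E = P (x + (u′ + d)) ; pair D′ E′ = Q in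
      pair (schur {a≉0 = 1≉0} D D′ rσ (unit refl))
           (schur E E′ rτ (unit (solve 4 (λ x g d u → (x :+ (g :+ d)) :+ u := (x :+ (u :+ d)) :+ g) refl x g d u′)))

    IF·NN : IF t m b → NN s m′ b′ → IF (t ◁ s) (m ℕ.+ m′) (b ℕ.+ b′)
    IF·NN P (σ , τ , u′ , d , pair D′ E′ , rσ , rτ , d≥0) y =
      let pair D E = P (y + u′) in
      pair (keep {a≉0 = 1≉0} D D′ rσ) (schur E E′ rτ (unit refl))

    FI·NN : FI t m b → NN s m′ b′ → FI (t ◁ s) (m ℕ.+ m′) (b ℕ.+ b′)
    FI·NN P (σ , τ , u′ , d , pair D′ E′ , rσ , rτ , d≥0) x =
      let pair D E = P (x + (u′ + d)) in
      pair (schur {a≉0 = 1≉0} D D′ rσ (unit refl)) (keep E E′ rτ)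

    II·NN : II t m b → NN s m′ b′ → II (t ◁ s) (m ℕ.+ m′) (b ℕ.+ b′)
    II·NN (pair D E) (σ , τ , u′ , d , pair D′ E′ , rσ , rτ , d≥0) =
      pair (keep {a≉0 = 1≉0} D D′ rσ) (keep E E′ rτ)

    Tunable·NN : Tunable t m b → NN s m′ b′ → Tunable (t ◁ s) (m ℕ.+ m′) (b ℕ.+ b′)
    Tunable·NN P (σ , τ , u′ , d , pair D′ E′ , rσ , rτ , d≥0) y c c≥0 =
      let pair D E = P (y + u′) (c + d) (nonNeg-+ c≥0 d≥0) in
      pair (schur {a≉0 = 1≉0} D D′ rσ
             (unit (solve 4 (λ y c d u → (y :+ c) :+ (u :+ d) := (y :+ u) :+ (c :+ d)) refl y c d u′)))
           (schur E E′ rτ (unit refl))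

    -- The upper part has some gap g > 0 that is not under control; a branch that lowers the gap by
    -- g + c leaves -c.
    FF·Steep : FF t m b → Steep s m′ b′ → Tunable (t ◁ s) (m ℕ.+ m′) (b ℕ.+ b′)
    FF·Steep (g , g>0 , P) Q y c c≥0 with Q (g + c) (positive-+ g>0 c≥0)
    ... | a , a≉0 , σ , τ , u , u′ , pair D′ E′ , rσ , rτ , eq =
      let pair D E = P ((y + c) + a * a * u) in
      pair (schur {a≉0 = a≉0} D D′ rσ refl)
           (schur E E′ rτ (begin
             y + a * a * u′                 ≈⟨ +-congˡ (sym eq) ⟩
             y + (a * a * u + (g + c))
               ≈⟨ solve 4 (λ y p g c → y :+ (p :+ (g :+ c)) := ((y :+ c) :+ p) :+ g) refl y (a * a * u) g c ⟩
             ((y + c) + a * a * u) + g      ∎))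

    FF·ZN : FF t m b → ZN s m′ b′ → IF (t ◁ s) (m ℕ.+ m′) (b ℕ.+ b′)
    FF·ZN (g , _ , P) (τ , pair D′ E′ , u′ , rτ) y =
      let pair D E = P ((y + u′) + - g) in
      pair (kill {a≉0 = 1≉0} D D′ refl)
           (schur E E′ rτ (unit (solve 3 (λ y u g → y :+ u := ((y :+ u) :- g) :+ g) refl y u′ g)))

    IF·ZN : IF t m b → ZN s m′ b′ → IF (t ◁ s) (suc (m ℕ.+ m′)) (b ℕ.+ b′)
    IF·ZN P (τ , pair D′ E′ , u′ , rτ) y =
      let pair D E = P (y + u′) in
      pair (gain {a≉0 = 1≉0} D D′ refl) (schur E E′ rτ (unit refl))

    FI·ZN : FI t m b → ZN s m′ b′ → II (t ◁ s) (m ℕ.+ m′) (b ℕ.+ b′)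
    FI·ZN P (τ , pair D′ E′ , u′ , rτ) =
      let pair D E = P 0# in pair (kill {a≉0 = 1≉0} D D′ refl) (keep E E′ rτ)

    II·ZN : II t m b → ZN s m′ b′ → II (t ◁ s) (suc (m ℕ.+ m′)) (b ℕ.+ b′)
    II·ZN (pair D E) (τ , pair D′ E′ , u′ , rτ) =
      pair (gain {a≉0 = 1≉0} D D′ refl) (keep E E′ rτ)

    FF·NZ : FF t m b → NZ s m′ b′ → FI (t ◁ s) (m ℕ.+ m′) (b ℕ.+ b′)
    FF·NZ (g , _ , P) (σ , y , pair D′ E′ , y≈0 , u , rσ) x =
      let pair D E = P (x + u) in
      pair (schur {a≉0 = 1≉0} D D′ rσ (unit refl)) (kill E E′ y≈0)

    FI·NZ : FI t m b → NZ s m′ b′ → FI (t ◁ s) (m ℕ.+ m′) (suc (b ℕ.+ b′))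
    FI·NZ P (σ , y , pair D′ E′ , y≈0 , u , rσ) x =
      let pair D E = P (x + u) in
      pair (schur {a≉0 = 1≉0} D D′ rσ (unit refl)) (gain E E′ y≈0)

    II·NZ : II t m b → NZ s m′ b′ → II (t ◁ s) (m ℕ.+ m′) (suc (b ℕ.+ b′))
    II·NZ (pair D E) (σ , y , pair D′ E′ , y≈0 , u , rσ) =
      pair (keep {a≉0 = 1≉0} D D′ rσ) (gain E E′ y≈0)

    FF·ZZ : FF t m b → ZZ s m′ b′ → II (t ◁ s) (m ℕ.+ m′) (b ℕ.+ b′)
    FF·ZZ (g , _ , P) (x , pair D′ E′ , x≈0) =
      let pair D E = P 0# in pair (kill {a≉0 = 1≉0} D D′ x≈0) (kill E E′ refl)

    FI·ZZ : FI t m b → ZZ s m′ b′ → II (t ◁ s) (m ℕ.+ m′) (suc (b ℕ.+ b′))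
    FI·ZZ P (x , pair D′ E′ , x≈0) =
      let pair D E = P 0# in pair (kill {a≉0 = 1≉0} D D′ x≈0) (gain E E′ refl)

    II·ZZ : II t m b → ZZ s m′ b′ → II (t ◁ s) (suc (m ℕ.+ m′)) (suc (b ℕ.+ b′))
    II·ZZ (pair D E) (x , pair D′ E′ , x≈0) =
      pair (gain {a≉0 = 1≉0} D D′ x≈0) (gain E E′ refl)

  module _ {lam : Carrier} where

    -- The given elimination serves only as a pattern: it is replayed at 0 with new weights and
    -- without excess at -1. A child's pivot that vanishes at 0 does not vanish at -1, because the
    -- gap is positive.
    basic-FF : ∀ {t} {w : Weights t} {n d} → Elim lam w n (fin d) → FF t n 0
    basic-IF : ∀ {t} {w : Weights t} {n} → Elim lam w n ∞ → IF t n 0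
    basic-NN : ∀ {t} {w : Weights t} {n σ} → Elim lam w n σ → NN t n 0

    basic-FF (leaf _)        = FF-leaf
    basic-FF (schur D E _ _) = FF·NN (basic-FF D) (basic-NN E)

    basic-IF (keep D E _) = IF·NN (basic-IF D) (basic-NN E)
    basic-IF (kill D E _) = FF·ZN (basic-FF D) (FF⇒ZN (basic-FF E))
    basic-IF (gain D E _) = IF·ZN (basic-IF D) (FF⇒ZN (basic-FF E))

    basic-NN {σ = fin _} D = FF⇒NN (basic-FF D)
    basic-NN {σ = ∞}     D = IF⇒NN (basic-IF D)

    basic-NZ : ∀ {t} {w : Weights t} {n σ} → Elim lam w n σ → NZ t n 0
    basic-NZ {σ = fin _} D = FF⇒NZ (basic-FF D)
    basic-NZ {σ = ∞}     D = IF⇒NZ (basic-IF D)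

    basic-Steep : ∀ {t} {w : Weights t} {n σ} → Elim lam w n σ → Steep t n 0
    basic-Steep {σ = fin _} D = FF⇒Steep (basic-FF D)
    basic-Steep {σ = ∞}     D = IF⇒Steep (basic-IF D)

    -- Every branch is steep by `basic-Steep`, so the last edge attached to a root of finite pivot
    -- can tune the gap.
    leaf-or-tunable : ∀ {t} {w : Weights t} {n d} → Elim lam w n (fin d) → t ≡ • ⊎ Tunable t n 0
    leaf-or-tunable (leaf _)        = inj₁ ≡.refl
    leaf-or-tunable (schur D E _ _) = inj₂ (FF·Steep (basic-FF D) (basic-Steep E))

  -- Moving units of multiplicity from one eigenvalue to the other.

  -- Any number of the n units can be moved from the eigenvalue 0 to −1.
  Splits : (ℕ → ℕ → Set) → ℕ → Set
  Splits P n = ∀ m b → m ℕ.+ b ≡ n → P m b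

  -- The m units that stay at 0 are taken from the first summand as long as it lasts.
  splits-+ : ∀ {P Q R : ℕ → ℕ → Set} {n n′} →
    (∀ {m b m′ b′} → P m b → Q m′ b′ → R (m ℕ.+ m′) (b ℕ.+ b′)) →
    Splits P n → Splits Q n′ → Splits R (n ℕ.+ n′)
  splits-+ {n = zero} f p q m b eq = f (p 0 0 ≡.refl) (q m b eq)
  splits-+ {R = R} {n = suc n} {n′} f p q zero b eq =
    ≡.subst (R 0) (≡.sym eq) (f (p 0 (suc n) ≡.refl) (q 0 n′ ≡.refl))
  splits-+ {P} {R = R} {n = suc n} f p q (suc m) b eq =
    splits-+ {P = λ i → P (suc i)} {R = λ i → R (suc i)} f
      (λ i j e → p (suc i) j (≡.cong suc e)) q m b (ℕ.suc-injective eq)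

  splits-0 : ∀ {P n} → Splits P n → P n 0
  splits-0 p = p _ 0 (ℕ.+-identityʳ _)

  -- What can be realised, given an elimination with n excess vanishing pivots that
  -- leaves a finite pivot at the root.  The aim, achieved by done, is to give up two
  -- of these at the eigenvalue 0 and to have two at −1.  A vertex with at least
  -- three children of vanishing pivot, all its branches being leaves, yields only
  -- one at −1, and the second has to come from elsewhere (half), which is
  -- impossible if that vertex and the root are the whole tree (bare).
  data ReportF : Tree → ℕ → Set where
    thin : ∀ {t n} → Splits (FF t) n → t ≡ • ⊎ FI t n 0 → ReportF t n
    done : ∀ {t m} b → FF t m (2 ℕ.+ b) → ReportF t (2 ℕ.+ m)
    half : ∀ {t m} → FF t m 1 → Tunable t m 1 → ReportF t (2 ℕ.+ m)
    bare : ∀ {s m} → Flat s → FF (• ◁ s) m 1 → ReportF (• ◁ s) (2 ℕ.+ m)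

  -- one and two: the number of children with vanishing pivot.  The last argument
  -- prepares for the arrival of a third such child; then three of the branches
  -- must get a vanishing pivot at −1, only two of which may lose that at 0.
  data ReportI : Tree → ℕ → Set where
    one    : ∀ {t n} → Splits (IF t) n → Splits (FI t) n →
             Flat t ⊎ FI t n 1 ⊎ II t n 0 → ReportI t n
    two    : ∀ {t n} → Splits (λ m → IF t (suc m)) n → Splits (λ m b → FI t m (suc b)) n →
             Flat t ⊎ FI t n 2 ⊎ II t n 1 → ReportI t (suc n)
    flower : ∀ {t m} → Flat t → II t m 1 → ReportI t (2 ℕ.+ m)
    doneIF : ∀ {t m} b → IF t m (2 ℕ.+ b) → ReportI t (2 ℕ.+ m)
    doneII : ∀ {t m} b → II t m (2 ℕ.+ b) → ReportI t (2 ℕ.+ m)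
    half   : ∀ {t m} → IF t m 1 → ReportI t (2 ℕ.+ m)

  -- At the root of a `flower` both pivots are ∞, so the branch is not known to be steep; this is
  -- what separates it from `half`.
  data ReportN : Tree → ℕ → Set where
    thin   : ∀ {s n} → Splits (NN s) n → ReportN s n
    done   : ∀ {s m} b → NN s m (2 ℕ.+ b) → ReportN s (2 ℕ.+ m)
    half   : ∀ {s m} → NN s m 1 → Steep s m 1 → ReportN s (2 ℕ.+ m)
    flower : ∀ {s m} → Flat s → NN s m 1 → ReportN s (2 ℕ.+ m)

  data ReportZ : Tree → ℕ → Set where
    thin : ∀ {s n} → Splits (ZN s) n → Splits (NZ s) n → s ≡ • ⊎ ZZ s n 0 → ReportZ s n
    done : ∀ {s m} b → ZN s m (2 ℕ.+ b) → ReportZ s (2 ℕ.+ m)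
    half : ∀ {s m} → ZN s m 1 → ReportZ s (2 ℕ.+ m)

  F⇒N : ∀ {s n} → ReportF s n → ReportN s n
  F⇒N (thin p _) = thin (λ m b eq → FF⇒NN (p m b eq))
  F⇒N (done b p) = done b (FF⇒NN p)
  F⇒N (half p _) = half (FF⇒NN p) (FF⇒Steep p)
  F⇒N (bare _ p) = half (FF⇒NN p) (FF⇒Steep p)

  I⇒N : ∀ {s n} → ReportI s n → ReportN s n
  I⇒N (one p _ _)  = thin (λ m b eq → IF⇒NN (p m b eq))
  I⇒N {s} (two {n = n} p q _) = thin splits
    where
    splits : Splits (NN s) (suc n)
    -- The unit of the second child with vanishing pivot stays at 0 in the first family and moves to
    -- -1 in the second; together the two give all splits.
    splits (suc m) zero eq = IF⇒NN (p m 0 (ℕ.suc-injective eq))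
    splits m (suc b) eq = FI⇒NN (q m b (ℕ.suc-injective (≡.trans (≡.sym (ℕ.+-suc m b)) eq)))
  I⇒N (flower f p) = flower f (II⇒NN p)
  I⇒N (doneIF b p) = done b (IF⇒NN p)
  I⇒N (doneII b p) = done b (II⇒NN p)
  I⇒N (half p)     = half (IF⇒NN p) (IF⇒Steep p)

  F⇒Z : ∀ {s n} → ReportF s n → s ≡ • ⊎ ZZ s n 0 → ReportZ s n
  F⇒Z (thin p _) z = thin (λ m b eq → FF⇒ZN (p m b eq)) (λ m b eq → FF⇒NZ (p m b eq)) z
  F⇒Z (done b p) _ = done b (FF⇒ZN p)
  F⇒Z (half p _) _ = half (FF⇒ZN p)
  F⇒Z (bare _ p) _ = half (FF⇒ZN p)

  shift : ∀ (P : ℕ → Set) n {m} → P (2 ℕ.+ (n ℕ.+ m)) → P (n ℕ.+ (2 ℕ.+ m))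
  shift P n {m} = ≡.subst P (≡.sym (≡.trans (ℕ.+-suc n (suc m)) (≡.cong suc (ℕ.+-suc n m))))

  -- Losing two units in one of the parts is enough, so the other is realised in a basic mode; only
  -- two `thin` parts combine their splits. A flower below a single vertex is `bare`, while a
  -- tunable upper part makes it `half`.
  reportF-step : ∀ {t s n n′} → FF t n 0 → t ≡ • ⊎ Tunable t n 0 →
    NN s n′ 0 → NZ s n′ 0 → Steep s n′ 0 →
    ReportF t n → ReportN s n′ → ReportF (t ◁ s) (n ℕ.+ n′)
  reportF-step {n = n} ff _ _ _ _ _ (done b q) = shift (ReportF _) n (done b (FF·NN ff q))
  reportF-step {n = n} ff _ _ _ _ _ (half q st) = shift (ReportF _) n (half (FF·NN ff q) (FF·Steep ff st))
  reportF-step {n = n} ff (inj₁ ≡.refl) _ _ _ _ (flower f q) = shift (ReportF _) n (bare f (FF·NN ff q))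
  reportF-step {n = n} ff (inj₂ tun) _ _ _ _ (flower f q) =
    shift (ReportF _) n (half (FF·NN ff q) (Tunable·NN tun q))
  reportF-step ff _ nn nz st (thin p _)   (thin q) = thin (splits-+ FF·NN p q) (inj₂ (FF·NZ ff nz))
  reportF-step ff _ nn nz st (done b p)   (thin q) = done _ (FF·NN p nn)
  reportF-step ff _ nn nz st (half p tun) (thin q) = half (FF·NN p nn) (Tunable·NN tun nn)
  reportF-step ff _ nn nz st (bare _ p)   (thin q) = half (FF·NN p nn) (FF·Steep p st)

  -- Through `NZ`, a child whose pivot does not vanish at 0 gets a vanishing pivot at -1 without
  -- loss at 0; it is the third branch that `one`, `two` and `flower` wait for.
  reportI-keep : ∀ {t s n n′} → IF t n 0 → NN s n′ 0 → NZ s n′ 0 →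
    ReportI t n → ReportN s n′ → ReportI (t ◁ s) (n ℕ.+ n′)
  reportI-keep {n = n} i _ _ _ (done b q)   = shift (ReportI _) n (doneIF b (IF·NN i q))
  reportI-keep {n = n} i _ _ _ (half q _)   = shift (ReportI _) n (half (IF·NN i q))
  reportI-keep {n = n} i _ _ _ (flower _ q) = shift (ReportI _) n (half (IF·NN i q))
  reportI-keep i nn nz (one p p′ _)  (thin q) =
    one (splits-+ IF·NN p q) (splits-+ FI·NN p′ q) (inj₂ (inj₁ (FI·NZ (splits-0 p′) nz)))
  reportI-keep i nn nz (two p p′ _)  (thin q) =
    two (splits-+ IF·NN p q) (splits-+ FI·NN p′ q) (inj₂ (inj₁ (FI·NZ (splits-0 p′) nz)))
  reportI-keep i nn nz (flower _ p)  (thin q) = doneII _ (II·NZ p nz)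
  reportI-keep i nn nz (doneIF b p)  (thin q) = doneIF _ (IF·NN p nn)
  reportI-keep i nn nz (doneII b p)  (thin q) = doneII _ (II·NN p nn)
  reportI-keep i nn nz (half p)      (thin q) = half (IF·NN p nn)

  reportI-kill : ∀ {t s n n′} → FF t n 0 → ZN s n′ 0 → NZ s n′ 0 →
    ReportF t n → ReportZ s n′ → ReportI (t ◁ s) (n ℕ.+ n′)
  reportI-kill {n = n} ff _ _ _ (done b q) = shift (ReportI _) n (doneIF b (FF·ZN ff q))
  reportI-kill {n = n} ff _ _ _ (half q)   = shift (ReportI _) n (half (FF·ZN ff q))
  reportI-kill ff zn nz (thin p k) (thin q q′ z) =
    one (splits-+ FF·ZN p q) (splits-+ FF·NZ p q′) (third k z)
    where
    -- Two single vertices form a star. A larger new branch can vanish at both eigenvalues.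
    -- Otherwise the upper part already has a branch with vanishing pivot at -1.
    third : _ → _ → _
    third (inj₁ ≡.refl) (inj₁ ≡.refl) = inj₁ (• ◁•)
    third (inj₁ _)      (inj₂ zz)     = inj₂ (inj₂ (FF·ZZ ff zz))
    third (inj₂ fi)     _             = inj₂ (inj₁ (FI·NZ fi nz))
  reportI-kill ff zn nz (done b p) (thin _ _ _) = doneIF _ (FF·ZN p zn)
  reportI-kill ff zn nz (half p _) (thin _ _ _) = half (FF·ZN p zn)
  reportI-kill ff zn nz (bare _ p) (thin _ _ _) = half (FF·ZN p zn)

  reportI-gain : ∀ {t s n n′} → IF t n 0 → ZN s n′ 0 → NZ s n′ 0 →
    ReportI t n → ReportZ s n′ → ReportI (t ◁ s) (suc (n ℕ.+ n′))
  reportI-gain {n = n} i _ _ _ (done b q) = shift (ReportI _) (suc n) (doneIF b (IF·ZN i q))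
  reportI-gain {n = n} i _ _ _ (half q)   = shift (ReportI _) (suc n) (half (IF·ZN i q))
  reportI-gain i zn nz (one p p′ k) (thin q q′ z) =
    two (splits-+ IF·ZN p q) (splits-+ FI·NZ p′ q′) (third k z)
    where
    third : _ → _ → _
    third (inj₁ f)         (inj₁ ≡.refl) = inj₁ (f ◁•)
    third (inj₁ _)         (inj₂ zz)     = inj₂ (inj₂ (FI·ZZ (splits-0 p′) zz))
    third (inj₂ (inj₁ fi)) _             = inj₂ (inj₁ (FI·NZ fi nz))
    third (inj₂ (inj₂ ii)) _             = inj₂ (inj₂ (II·NZ ii nz))
  -- The first two children vanish at -1 instead, which is worth one unit there, and the third takes
  -- over the pairing at 0. All branches are leaves.
  reportI-gain i zn nz (two p p′ (inj₁ f)) (thin _ _ (inj₁ ≡.refl)) = flower (f ◁•) (FI·ZN (splits-0 p′) zn)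
  reportI-gain i zn nz (two p p′ (inj₁ f)) (thin _ _ (inj₂ zz))     = doneII 0 (FI·ZZ (splits-0 p′) zz)
  reportI-gain i zn nz (two p p′ (inj₂ (inj₁ fi))) (thin _ _ _)     = doneII 0 (FI·ZN fi zn)
  -- Here one of the first two children vanishes at both eigenvalues and is the one paired at 0, so
  -- the third needs to vanish at -1 only.
  reportI-gain i zn nz (two p p′ (inj₂ (inj₂ ii))) (thin _ _ _)     = doneII 0 (II·NZ ii nz)
  reportI-gain i zn nz (flower f p) (thin _ _ (inj₁ ≡.refl)) = flower (f ◁•) (II·ZN p zn)
  reportI-gain i zn nz (flower f p) (thin _ _ (inj₂ zz))     = doneII 0 (II·ZZ p zz)
  reportI-gain i zn nz (doneIF b p) (thin _ _ _) = doneIF _ (IF·ZN p zn)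
  reportI-gain i zn nz (doneII b p) (thin _ _ _) = doneII _ (II·ZN p zn)
  reportI-gain i zn nz (half p)     (thin _ _ _) = half (IF·ZN p zn)

  module _ {lam : Carrier} where

    reportF : ∀ {t} {w : Weights t} {n d} → Elim lam w n (fin d) → ReportF t n
    reportI : ∀ {t} {w : Weights t} {n} → Elim lam w n ∞ → ReportI t n
    reportN : ∀ {t} {w : Weights t} {n σ} → Elim lam w n σ → ReportN t n
    reportZ : ∀ {t} {w : Weights t} {n d} → Elim lam w n (fin d) → ReportZ t n

    reportF (leaf _) = thin (λ { zero zero _ → FF-leaf }) (inj₁ ≡.refl)
    reportF (schur D E _ _) = reportF-step (basic-FF D) (leaf-or-tunable D)
      (basic-NN E) (basic-NZ E) (basic-Steep E) (reportF D) (reportN E)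

    reportI (keep D E _) = reportI-keep (basic-IF D) (basic-NN E) (basic-NZ E) (reportI D) (reportN E)
    reportI (kill D E _) = reportI-kill (basic-FF D) (FF⇒ZN (basic-FF E)) (FF⇒NZ (basic-FF E)) (reportF D) (reportZ E)
    reportI (gain D E _) = reportI-gain (basic-IF D) (FF⇒ZN (basic-FF E)) (FF⇒NZ (basic-FF E)) (reportI D) (reportZ E)

    reportN {σ = fin _} D = F⇒N (reportF D)
    reportN {σ = ∞}     D = I⇒N (reportI D)

    reportZ D = F⇒Z (reportF D) (zz (leaf-or-tunable D))
      where
      zz : _ → _
      zz (inj₁ eq)  = inj₁ eq
      zz (inj₂ tun) = inj₂ (Tunable⇒ZZ tun)

  -- Counterexamples to simplicity of the other eigenvalues.

  record Counterexample (t : Tree) (M : ℕ) : Set where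
    field
      {weights} : Weights t
      {k}       : ℕ
      at0       : Nullity {0#} weights (M ∸ 2)
      at-1      : Nullity {(- 1#)} weights k
      2≤k       : 2 ℕ.≤ k

  nullity-∞ : ∀ {lam t} {w : Weights t} {m} → Elim lam w m ∞ → Nullity {lam} w m
  nullity-∞ D = ∞ , inj₁ (D , 0# , refl)

  nullity-fin : ∀ {lam t} {w : Weights t} {m d} → Elim lam w m (fin d) → d ≈ 0# → Nullity {lam} w (suc m)
  nullity-fin D d≈0 = _ , inj₂ (_ , D , d≈0 , ≡.refl)

  nullity≥2 : ∀ {lam t} {w : Weights t} {b τ} → Elim lam w (2 ℕ.+ b) τ →
    ∃[ k ] Nullity {lam} w k × 2 ℕ.≤ k
  nullity≥2 {b = b} {τ} D with vanishes-or-reciprocal τ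
  ... | inj₁ z = 3 ℕ.+ b , (_ , inj₂ (_ , D , z , ≡.refl)) , s≤s (s≤s z≤n)
  ... | inj₂ r = 2 ℕ.+ b , (_ , inj₁ (D , r)) , s≤s (s≤s z≤n)

  Outcome : Tree → ℕ → Set
  Outcome t M = Counterexample t M ⊎ Starlike t

  outcome : ∀ {t M} {w : Weights t} → Nullity {0#} w (M ∸ 2) →
    ∃[ k ] Nullity {(- 1#)} w k × 2 ℕ.≤ k → Outcome t M
  outcome N (k , N′ , 2≤k) = inj₁ (record { at0 = N ; at-1 = N′ ; 2≤k = 2≤k })

  -- `x` is the root pivot to be prescribed at 0: it is 0 if the root contributes to the
  -- multiplicity M, and 1 if it does not.
  outcome-F : ∀ {t M n} x → NonNeg x →
    (∀ {m x′} {w : Weights t} → n ≡ 2 ℕ.+ m → x′ ≈ x → Elim 0# w m (fin x′) →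
      Nullity {0#} w (M ∸ 2)) →
    2 ℕ.≤ n → ReportF t n → Outcome t M
  outcome-F x x≥0 N (s≤s (s≤s {n = m} z≤n)) (thin p _) =
    let (_ , _ , P) = p m 2 (ℕ.+-comm m 2) ; pair D E = P x in
    outcome (N ≡.refl refl D) (nullity≥2 E)
  outcome-F x x≥0 N _ (done b (_ , _ , P)) =
    let pair D E = P x in outcome (N ≡.refl refl D) (nullity≥2 E)
  -- Tuning makes the root pivot at -1 vanish, which supplies the second unit there.
  outcome-F x x≥0 N _ (half _ P) =
    let pair D E = P 0# x x≥0 in
    outcome (N ≡.refl (+-identityˡ x) D) (2 , nullity-fin E refl , ℕ.≤-refl)
  outcome-F x x≥0 N _ (bare f _) = inj₂ (tip f)

  outcome-I : ∀ {t n} → 3 ℕ.≤ n → ReportI t n → Outcome t n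
  outcome-I (s≤s (s≤s (s≤s {n = m} z≤n))) (one p _ _) =
    let pair D E = p (suc m) 2 (ℕ.+-comm (suc m) 2) 0# in outcome (nullity-∞ D) (nullity≥2 E)
  -- The unit of the root's second child with vanishing pivot stays at 0, so two others are moved;
  -- this takes at least three units.
  outcome-I (s≤s (s≤s (s≤s {n = m} z≤n))) (two p _ _) =
    let pair D E = p m 2 (ℕ.+-comm m 2) 0# in outcome (nullity-∞ D) (nullity≥2 E)
  outcome-I _ (flower f _) = inj₂ (centre f)
  outcome-I _ (doneIF b P) = let pair D E = P 0# in outcome (nullity-∞ D) (nullity≥2 E)
  outcome-I _ (doneII b (pair D E)) = outcome (nullity-∞ D) (nullity≥2 E)
  outcome-I _ (half P) =
    let pair D E = P 0# in outcome (nullity-∞ D) (2 , nullity-fin E refl , ℕ.≤-refl)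

  counterexample-or-star : ∀ {lam t M} {w : Weights t} → Nullity {lam} w M → 4 ℕ.≤ M → Outcome t M
  counterexample-or-star (∞ , inj₁ (D , _)) 4≤M = outcome-I (ℕ.≤-trans (ℕ.n≤1+n 3) 4≤M) (reportI D)
  counterexample-or-star (fin d , inj₁ (D , _)) 4≤M =
    outcome-F 1# (proj₁ positive-1)
      (λ { ≡.refl x≈1 D′ → _ , inj₁ (D′ , 1# , trans (*-identityʳ _) x≈1) })
      (ℕ.≤-trans (ℕ.m≤n+m 2 2) 4≤M) (reportF D)
  counterexample-or-star (fin d , inj₂ (n , D , z , ≡.refl)) (s≤s 3≤n) =
    outcome-F 0# (IsTotalOrder.refl isTotalOrder)
      (λ { ≡.refl x≈0 D′ → nullity-fin D′ x≈0 })
      (ℕ.≤-trans (ℕ.n≤1+n 2) 3≤n) (reportF D)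

  open Algebra.Properties.Semiring.Sum semiring
    using (sum; sum-cong-≋; sum-remove; ∑-distrib-+; ∑-comm; sum-permute;
           *-distribˡ-sum; *-distribʳ-sum; sum-replicate-zero)

  -- Multiplicities

  sum-zero : ∀ {n} (f : Vector Carrier n) → (∀ i → f i ≈ 0#) → sum f ≈ 0#
  sum-zero {n} f f≈0 = trans (sum-cong-≋ f≈0) (sum-replicate-zero n)

  -- Gaussian elimination of the first coordinate with row p; in the relation found, the coefficient
  -- of row p makes up for the multiples subtracted from the other rows.
  dependent : ∀ k m → k ℕ.< m → (B : Fin m → Fin k → Carrier) →
    ∃ λ (a : Fin m → Carrier) → ¬ (∀ j → a j ≈ 0#) × (∀ i → sum (λ j → a j * B j i) ≈ 0#)
  dependent zero (suc m) _ B = (λ _ → 1#) , (λ a≈0 → 1≉0 (a≈0 zero)) , λ ()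
  dependent (suc k) (suc (suc m)) (s≤s k<m) B = a , a≉0 , vanishes
    where
    Pivots : Set
    Pivots = ∃[ p ] ∃[ c ] ∀ l → B (punchIn p l) zero ≈ c l * B p zero

    pivots : Pivots
    pivots with em {∃[ p ] ¬ (B p zero ≈ 0#)}
    ... | yes (p , B≉0) = p , (λ l → B (punchIn p l) zero * i) , λ l → begin
        B (punchIn p l) zero                     ≈⟨ sym (*-identityʳ _) ⟩
        B (punchIn p l) zero * 1#                ≈⟨ *-congˡ (sym (proj₂ (inverse _ B≉0))) ⟩
        B (punchIn p l) zero * (B p zero * i)    ≈⟨ solve 3 (λ x y i → x :* (y :* i) := (x :* i) :* y) refl _ _ i ⟩
        (B (punchIn p l) zero * i) * B p zero    ∎
      where i = proj₁ (inverse _ B≉0)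
    -- All first coordinates vanish, so any row may serve as p, with multipliers 0.
    ... | no none = zero , (λ _ → 0#) , λ l → trans (B≈0 (suc l)) (sym (zeroˡ _))
      where
      B≈0 : ∀ j → B j zero ≈ 0#
      B≈0 j with zero? (B j zero)
      ... | yes z = z
      ... | no nz = ⊥-elim (none (j , nz))

    p = proj₁ pivots
    c = proj₁ (proj₂ pivots)

    E : Fin (suc m) → Fin (suc k) → Carrier
    E l i = B (punchIn p l) i + - (c l * B p i)

    smaller = dependent k (suc m) k<m (λ l i → E l (suc i))
    a′ = proj₁ smaller

    E-vanishes : ∀ i → sum (λ l → a′ l * E l i) ≈ 0#
    E-vanishes zero    = sum-zero (λ l → a′ l * E l zero) λ l →
      trans (*-congˡ {a′ l} (trans (+-congʳ (proj₂ (proj₂ pivots) l)) (-‿inverseʳ _))) (zeroʳ _)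
    E-vanishes (suc i) = proj₂ (proj₂ smaller) i

    a : Fin (suc (suc m)) → Carrier
    a = insertAt a′ p (- sum (λ l → a′ l * c l))

    a-punchIn : ∀ l → a (punchIn p l) ≈ a′ l
    a-punchIn l = reflexive (insertAt-punchIn a′ p _ l)

    a≉0 : ¬ (∀ j → a j ≈ 0#)
    a≉0 a≈0 = proj₁ (proj₂ smaller) (λ l → trans (sym (a-punchIn l)) (a≈0 (punchIn p l)))

    vanishes : ∀ i → sum (λ j → a j * B j i) ≈ 0#
    vanishes i = begin
      sum (λ j → a j * B j i)
        ≈⟨ sum-remove {i = p} (λ j → a j * B j i) ⟩
      a p * B p i + sum (λ l → a (punchIn p l) * B (punchIn p l) i)
        ≈⟨ +-cong (*-congʳ (reflexive (insertAt-lookup a′ p _))) (sum-cong-≋ λ l → trans (*-congʳ (a-punchIn l))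
             (solve 4 (λ a b c d → a :* b := a :* (b :- c :* d) :+ (a :* c) :* d) refl
                (a′ l) (B (punchIn p l) i) (c l) (B p i))) ⟩
      - sum (λ l → a′ l * c l) * B p i + sum (λ l → a′ l * E l i + (a′ l * c l) * B p i)
        ≈⟨ +-congˡ (trans (∑-distrib-+ (λ l → a′ l * E l i) (λ l → (a′ l * c l) * B p i))
             (+-cong (E-vanishes i) (sym (*-distribʳ-sum (B p i) (λ l → a′ l * c l))))) ⟩
      - sum (λ l → a′ l * c l) * B p i + (0# + sum (λ l → a′ l * c l) * B p i)
        ≈⟨ solve 2 (λ s b → (:- s) :* b :+ (:0 :+ s :* b) := :0) refl _ _ ⟩
      0# ∎

  combine-combinations : ∀ {n k m} (a : Vector Carrier m) (B : Fin m → Fin k → Carrier)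
    (v : Vector (Vector Carrier n) k) (i : Fin n) →
    sum (λ j → a j * linearCombination ℝ (B j) v i) ≈ linearCombination ℝ (λ r → sum (λ j → a j * B j r)) v i
  combine-combinations a B v i = begin
    sum (λ j → a j * sum (λ r → B j r * v r i))
      ≈⟨ sum-cong-≋ (λ j → trans (*-distribˡ-sum (a j) (λ r → B j r * v r i))
           (sum-cong-≋ (λ r → sym (*-assoc (a j) (B j r) (v r i))))) ⟩
    sum (λ j → sum (λ r → (a j * B j r) * v r i))
      ≈⟨ ∑-comm (λ j r → (a j * B j r) * v r i) ⟩
    sum (λ r → sum (λ j → (a j * B j r) * v r i))
      ≈⟨ sum-cong-≋ (λ r → sym (*-distribʳ-sum (v r i) (λ j → a j * B j r))) ⟩
    sum (λ r → sum (λ j → a j * B j r) * v r i) ∎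

  -- Expanding m independent vectors in k < m others would produce a nontrivial relation between
  -- them.
  multiplicity-≤ : ∀ {n} {A : Matrix ℝ n} {μ m k} →
    HasMultiplicity ℝ A μ m → HasMultiplicity ℝ A μ k → m ℕ.≤ k
  multiplicity-≤ {n} {A} {m = m} {k} H K with ℕ.≤-<-connex m k
  ... | inj₁ m≤k = m≤k
  ... | inj₂ k<m = ⊥-elim (proj₁ (proj₂ dep) (H.independent a λ i → begin
      sum (λ j → a j * H.basis j i)                      ≈⟨ sum-cong-≋ (λ j → *-congˡ (proj₂ (expand j) i)) ⟩
      sum (λ j → a j * linearCombination ℝ (B j) K.basis i) ≈⟨ combine-combinations a B K.basis i ⟩
      linearCombination ℝ (λ r → sum (λ j → a j * B j r)) K.basis i
        ≈⟨ sum-zero _ (λ r → trans (*-congʳ (proj₂ (proj₂ dep) r)) (zeroˡ _)) ⟩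
      0# ∎))
    where
    module H = HasMultiplicity H
    module K = HasMultiplicity K
    expand = λ j → K.spanning (H.basis j) (H.inside j)
    B = λ j → proj₁ (expand j)
    dep = dependent k m k<m B
    a = proj₁ dep

  multiplicity-unique : ∀ {n} {A : Matrix ℝ n} {μ m k} →
    HasMultiplicity ℝ A μ m → HasMultiplicity ℝ A μ k → m ≡ k
  multiplicity-unique H K = ℕ.≤-antisym (multiplicity-≤ H K) (multiplicity-≤ K H)

  eigenspace-combination : ∀ {n k} {A : Matrix ℝ n} {μ} (a : Vector Carrier k) (v : Vector (Vector Carrier n) k) →
    (∀ r → Eigenspace ℝ A μ (v r)) → Eigenspace ℝ A μ (linearCombination ℝ a v)
  eigenspace-combination {A = A} {μ} a v E i = begin
    sum (λ j → A i j * sum (λ r → a r * v r j))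
      ≈⟨ sum-cong-≋ (λ j → trans (*-distribˡ-sum (A i j) (λ r → a r * v r j))
           (sum-cong-≋ (λ r → solve 3 (λ x a v → x :* (a :* v) := a :* (x :* v)) refl (A i j) (a r) (v r j)))) ⟩
    sum (λ j → sum (λ r → a r * (A i j * v r j)))
      ≈⟨ ∑-comm (λ j r → a r * (A i j * v r j)) ⟩
    sum (λ r → sum (λ j → a r * (A i j * v r j)))
      ≈⟨ sum-cong-≋ (λ r → trans (sym (*-distribˡ-sum (a r) (λ j → A i j * v r j))) (*-congˡ (E r i))) ⟩
    sum (λ r → a r * (μ * v r i))
      ≈⟨ sum-cong-≋ (λ r → solve 3 (λ a μ v → a :* (μ :* v) := μ :* (a :* v)) refl (a r) μ (v r i)) ⟩
    sum (λ r → μ * (a r * v r i))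
      ≈⟨ sym (*-distribˡ-sum μ (λ r → a r * v r i)) ⟩
    μ * sum (λ r → a r * v r i) ∎

  unitVector : ∀ {m} → Fin m → Vector Carrier m
  unitVector zero    zero    = 1#
  unitVector zero    (suc j) = 0#
  unitVector (suc i) zero    = 0#
  unitVector (suc i) (suc j) = unitVector i j

  sum-unitVector : ∀ {m} (a : Vector Carrier m) i → sum (λ r → a r * unitVector r i) ≈ a i
  sum-unitVector a zero = trans (+-cong (*-identityʳ _) (sum-zero _ (λ r → zeroʳ (a (suc r))))) (+-identityʳ _)
  sum-unitVector a (suc i) = trans (+-cong (zeroʳ _) (sum-unitVector (a ∘ suc) i)) (+-identityˡ _)

  -- The basis is dual to the coordinates. A vector minus its expansion vanishes at all positions,
  -- hence everywhere.
  multiplicity-by-coordinates : ∀ {n} {A : Matrix ℝ n} {μ m} (p : Fin m → Fin n) →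
    (∀ (f : Vector Carrier m) → ∃[ x ] Eigenspace ℝ A μ x × ∀ r → x (p r) ≈ f r) →
    (∀ x → Eigenspace ℝ A μ x → (∀ r → x (p r) ≈ 0#) → ∀ i → x i ≈ 0#) →
    HasMultiplicity ℝ A μ m
  multiplicity-by-coordinates {n} {A} {μ} {m} p kernel trivial = record
    { basis = basis
    ; inside = inside
    ; independent = λ a z r → trans (sym (at-p a r)) (z (p r))
    ; spanning = λ x E → (x ∘ p) , λ i → expansion x E i
    }
    where
    basis : Vector (Vector Carrier n) m
    basis r = proj₁ (kernel (unitVector r))
    inside : ∀ r → Eigenspace ℝ A μ (basis r)
    inside r = proj₁ (proj₂ (kernel (unitVector r)))

    at-p : ∀ a r → linearCombination ℝ a basis (p r) ≈ a r
    at-p a r = trans (sum-cong-≋ (λ s → *-congˡ (proj₂ (proj₂ (kernel (unitVector s))) r))) (sum-unitVector a r)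

    module _ (x : Vector Carrier n) (E : Eigenspace ℝ A μ x) where
      vectors : Vector (Vector Carrier n) (suc m)
      vectors zero    = x
      vectors (suc r) = basis r
      coefficients : Vector Carrier (suc m)
      coefficients zero    = - 1#
      coefficients (suc r) = x (p r)

      difference-zero : ∀ i → linearCombination ℝ coefficients vectors i ≈ 0#
      difference-zero = trivial _
        (eigenspace-combination coefficients vectors λ { zero → E ; (suc r) → inside r })
        (λ r → trans (+-congˡ (at-p (x ∘ p) r)) (solve 1 (λ y → (:- :1) :* y :+ y := :0) refl (x (p r))))

      expansion : ∀ i → x i ≈ linearCombination ℝ (x ∘ p) basis i
      expansion i = begin
        x i                                                   ≈⟨ sym (+-identityʳ _) ⟩
        x i + 0#                                              ≈⟨ +-congˡ (sym (difference-zero i)) ⟩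
        x i + (- 1# * x i + linearCombination ℝ (x ∘ p) basis i)
          ≈⟨ solve 2 (λ x y → x :+ ((:- :1) :* x :+ y) := y) refl (x i) _ ⟩
        linearCombination ℝ (x ∘ p) basis i                   ∎

  -- Weighted trees as matrices.

  size : Tree → ℕ
  size •       = 1
  size (t ◁ s) = size t ℕ.+ size s

  Vertex↔⊎ : ∀ {t s} → Vertex (t ◁ s) ↔ (Vertex t ⊎ Vertex s)
  Vertex↔⊎ = mk↔ₛ′ (λ { (left u) → inj₁ u ; (right v) → inj₂ v }) [ left , right ]′
    (λ { (inj₁ _) → ≡.refl ; (inj₂ _) → ≡.refl }) (λ { (left _) → ≡.refl ; (right _) → ≡.refl })

  Vertex↔Fin : ∀ t → Vertex t ↔ Fin (size t)
  Vertex↔Fin •       = mk↔ₛ′ (λ _ → zero) (λ _ → top) (λ { zero → ≡.refl }) (λ { top → ≡.refl })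
  Vertex↔Fin (t ◁ s) = ⊎↔Fin {0#} (Vertex↔Fin t) (Vertex↔Fin s) ↔-∘ Vertex↔⊎

  vertexOf : ∀ t → Fin (size t) → Vertex t
  vertexOf t = Inverse.from (Vertex↔Fin t)

  sumV : ∀ {t} → (Vertex t → Carrier) → Carrier
  sumV {•}     f = f top
  sumV {t ◁ s} f = sumV (f ∘ left) + sumV (f ∘ right)

  sumV-cong : ∀ {t} {f g : Vertex t → Carrier} → (∀ v → f v ≈ g v) → sumV f ≈ sumV g
  sumV-cong {•}     eq = eq top
  sumV-cong {t ◁ s} eq = +-cong (sumV-cong (eq ∘ left)) (sumV-cong (eq ∘ right))

  sumV-zero : ∀ {t} {f : Vertex t → Carrier} → (∀ v → f v ≈ 0#) → sumV f ≈ 0#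
  sumV-zero {•}     eq = eq top
  sumV-zero {t ◁ s} eq = trans (+-cong (sumV-zero (eq ∘ left)) (sumV-zero (eq ∘ right))) (+-identityˡ 0#)

  sum-↑ : ∀ m {n} (f : Vector Carrier (m ℕ.+ n)) → sum f ≈ sum (f ∘ (_↑ˡ n)) + sum (f ∘ (m ↑ʳ_))
  sum-↑ zero    f = sym (+-identityˡ _)
  sum-↑ (suc m) f = trans (+-congˡ (sum-↑ m (f ∘ suc))) (sym (+-assoc _ _ _))

  sum-vertexOf : ∀ t (f : Vertex t → Carrier) → sum (f ∘ vertexOf t) ≈ sumV f
  sum-vertexOf •       f = +-identityʳ _
  sum-vertexOf (t ◁ s) f = trans (sum-↑ (size t) (f ∘ vertexOf (t ◁ s)))
    (+-cong (trans (sum-cong-≋ λ i → reflexive (≡.cong f (left-index i))) (sum-vertexOf t (f ∘ left)))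
            (trans (sum-cong-≋ λ j → reflexive (≡.cong f (right-index j))) (sum-vertexOf s (f ∘ right))))
    where
    left-index : ∀ i → vertexOf (t ◁ s) (i ↑ˡ size s) ≡ left (vertexOf t i)
    left-index i rewrite splitAt-↑ˡ (size t) i (size s) = ≡.refl
    right-index : ∀ j → vertexOf (t ◁ s) (size t ↑ʳ j) ≡ right (vertexOf s j)
    right-index j rewrite splitAt-↑ʳ (size t) (size s) j = ≡.refl

  δ-cases : ∀ {t} (v : Vertex t) → v ≡ root t ⊎ δ v ≈ 0#
  δ-cases top       = inj₁ ≡.refl
  δ-cases (right v) = inj₂ refl
  δ-cases (left v) with δ-cases v
  ... | inj₁ eq = inj₁ (≡.cong left eq)
  ... | inj₂ z  = inj₂ z

  entry : ∀ {t} → Weights t → Vertex t → Vertex t → Carrier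
  entry (vertex w)      top       top       = w
  entry (join w a _ w′) (left u)  (left v)  = entry w u v
  entry (join w a _ w′) (right u) (right v) = entry w′ u v
  entry (join w a _ w′) (left u)  (right v) = δ u * (a * δ v)
  entry (join w a _ w′) (right u) (left v)  = δ u * (a * δ v)

  entry-sym : ∀ {t} (w : Weights t) u v → entry w u v ≈ entry w v u
  entry-sym (vertex w)      top       top       = refl
  entry-sym (join w a _ w′) (left u)  (left v)  = entry-sym w u v
  entry-sym (join w a _ w′) (right u) (right v) = entry-sym w′ u v
  entry-sym (join w a _ w′) (left u)  (right v) =
    solve 3 (λ x a y → x :* (a :* y) := y :* (a :* x)) refl (δ u) a (δ v)
  entry-sym (join w a _ w′) (right u) (left v)  =
    solve 3 (λ x a y → x :* (a :* y) := y :* (a :* x)) refl (δ u) a (δ v)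

  link-root : ∀ t s a → δ (root t) * (a * δ (root s)) ≈ a
  link-root t s a = trans (*-cong (δ-root t) (*-congˡ (δ-root s)))
    (solve 1 (λ a → :1 :* (a :* :1) := a) refl a)

  link-zero : ∀ {t s} (u : Vertex t) (v : Vertex s) a →
    (u ≡ root t × v ≡ root s) ⊎ δ u * (a * δ v) ≈ 0#
  link-zero u v a with δ-cases u | δ-cases v
  ... | inj₁ p | inj₁ q = inj₁ (p , q)
  ... | inj₂ z | _ = inj₂ (trans (*-congʳ z) (zeroˡ _))
  ... | inj₁ _ | inj₂ z = inj₂ (trans (*-congˡ (trans (*-congˡ z) (zeroʳ a))) (zeroʳ _))

  entry-edge : ∀ {t} (w : Weights t) {u v} → Edge u v → ¬ (entry w u v ≈ 0#)
  entry-edge (join w a _ w′) (left e)  = entry-edge w e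
  entry-edge (join w a _ w′) (right e) = entry-edge w′ e
  entry-edge {t ◁ s} (join w a a≉0 w′) down z = a≉0 (trans (sym (link-root t s a)) z)
  entry-edge {t ◁ s} (join w a a≉0 w′) up   z = a≉0 (trans (sym (link-root s t a)) z)

  edge-entry : ∀ {t} (w : Weights t) {u v} → u ≢ v → ¬ (entry w u v ≈ 0#) → Edge u v
  edge-entry (vertex w) {top} {top} u≢v _ = ⊥-elim (u≢v ≡.refl)
  edge-entry (join w a _ w′) {left u}  {left v}  u≢v nz = left (edge-entry w (u≢v ∘ ≡.cong left) nz)
  edge-entry (join w a _ w′) {right u} {right v} u≢v nz = right (edge-entry w′ (u≢v ∘ ≡.cong right) nz)
  edge-entry (join w a _ w′) {left u}  {right v} _ nz with link-zero u v a
  ... | inj₁ (≡.refl , ≡.refl) = down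
  ... | inj₂ z = ⊥-elim (nz z)
  edge-entry (join w a _ w′) {right u} {left v}  _ nz with link-zero u v a
  ... | inj₁ (≡.refl , ≡.refl) = up
  ... | inj₂ z = ⊥-elim (nz z)

  sumV-link : ∀ {t} c a (x : Vertex t → Carrier) → sumV (λ u → (c * (a * δ u)) * x u) ≈ c * (a * x (root t))
  sumV-link {•}     c a x = solve 3 (λ c a x → (c :* (a :* :1)) :* x := c :* (a :* x)) refl c a (x top)
  sumV-link {t ◁ s} c a x = trans (+-cong (sumV-link c a (x ∘ left))
    (sumV-zero (λ v → solve 3 (λ c a x → (c :* (a :* :0)) :* x := :0) refl c a (x (right v))))) (+-identityʳ _)

  row-sumV : ∀ {t} (w : Weights t) x v → row w x v ≈ sumV (λ u → entry w v u * x u)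
  row-sumV (vertex w) x top = refl
  row-sumV (join w a _ w′) x (left v)  =
    +-cong (row-sumV w (x ∘ left) v) (sym (sumV-link (δ v) a (x ∘ right)))
  row-sumV (join w a _ w′) x (right v) =
    trans (+-cong (row-sumV w′ (x ∘ right) v) (sym (sumV-link (δ v) a (x ∘ left)))) (+-comm _ _)

  row-cong : ∀ {t} (w : Weights t) {x y} → (∀ v → x v ≈ y v) → ∀ v → row w x v ≈ row w y v
  row-cong w eq v = trans (row-sumV w _ v)
    (trans (sumV-cong (λ u → *-congˡ (eq u))) (sym (row-sumV w _ v)))

  -- Only the two roots are joined across a `join`, so the off-diagonal block of `B` is determined
  -- by its entry there.
  weightsOf : ∀ {t} (B : Vertex t → Vertex t → Carrier) → (∀ u v → B u v ≈ B v u) →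
    (∀ {u v} → Edge u v → ¬ (B u v ≈ 0#)) → (∀ {u v} → u ≢ v → ¬ Edge u v → B u v ≈ 0#) →
    ∃[ w ] ∀ u v → entry {t} w u v ≈ B u v
  weightsOf {•} B _ _ _ = vertex (B top top) , λ { top top → refl }
  weightsOf {t ◁ s} B B-sym nonzero vanish
    with weightsOf (λ u v → B (left u) (left v)) (λ u v → B-sym (left u) (left v))
           (nonzero ∘ left) (λ u≢v ¬e → vanish (u≢v ∘ left-injective) λ { (left e) → ¬e e })
       | weightsOf (λ u v → B (right u) (right v)) (λ u v → B-sym (right u) (right v))
           (nonzero ∘ right) (λ u≢v ¬e → vanish (u≢v ∘ right-injective) λ { (right e) → ¬e e })
  ... | w , eq | w′ , eq′ = join w a (nonzero down) w′ , λ
    { (left u) (left v)   → eq u v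
    ; (right u) (right v) → eq′ u v
    ; (left u) (right v)  → link u v
    ; (right u) (left v)  → trans (solve 3 (λ x a y → x :* (a :* y) := y :* (a :* x)) refl (δ u) a (δ v))
                              (trans (link v u) (B-sym (left v) (right u))) }
    where
    a = B (left (root t)) (right (root s))
    link : ∀ u v → δ u * (a * δ v) ≈ B (left u) (right v)
    link u v with δ-cases u | δ-cases v
    ... | inj₁ ≡.refl | inj₁ ≡.refl = link-root t s a
    ... | inj₁ _ | inj₂ z = trans (trans (*-congˡ (trans (*-congˡ z) (zeroʳ a))) (zeroʳ _))
            (sym (vanish (λ ()) λ { down → 1≉0 (trans (sym (δ-root s)) z) }))
    ... | inj₂ z | _ = trans (trans (*-congʳ z) (zeroˡ _))
            (sym (vanish (λ ()) λ { down → 1≉0 (trans (sym (δ-root t)) z) }))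

  -- Transport along an encoding.

  module _ {n : ℕ} {T : Graph n} {r : Fin n} (enc : Encoding em T r) where
    open Encoding enc
    open Graph T

    position : Fin n → Vertex tree
    position i = proj₁ (surjective i)

    label-position : ∀ i → label (position i) ≡ i
    label-position i = proj₂ (surjective i)

    position-label : ∀ u → position (label u) ≡ u
    position-label u = injective (label-position (label u))

    sum-label : ∀ (g : Vector Carrier n) → sum g ≈ sumV (g ∘ label)
    sum-label g = trans (sum-permute g π) (sum-vertexOf tree (g ∘ label))
      where
      π : Permutation (size tree) n
      π = mk↔ₛ′ label position label-position position-label ↔-∘ ↔-sym (Vertex↔Fin tree)

    _Represents_ : Weights tree → Matrix ℝ n → Set
    w Represents A = ∀ u v → A (label u) (label v) ≈ entry w u v

    module _ {w : Weights tree} {A : Matrix ℝ n} (rep : w Represents A) (lam : Carrier) where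

      matrix-row : ∀ x v → sum (λ j → A (label v) j * x j) ≈ row w (x ∘ label) v
      matrix-row x v = begin
        sum (λ j → A (label v) j * x j)                    ≈⟨ sum-label (λ j → A (label v) j * x j) ⟩
        sumV (λ u → A (label v) (label u) * x (label u))   ≈⟨ sumV-cong (λ u → *-congʳ (rep v u)) ⟩
        sumV (λ u → entry w v u * x (label u))             ≈⟨ sym (row-sumV w (x ∘ label) v) ⟩
        row w (x ∘ label) v                                ∎

      Eigenspace⇒Solution : ∀ {x} → Eigenspace ℝ A lam x → Solution lam w (x ∘ label) 0#
      Eigenspace⇒Solution {x} E v = trans (sym (matrix-row x v)) (trans (E (label v))
        (sym (trans (+-congˡ (zeroʳ _)) (+-identityʳ _))))

      Solution⇒Eigenspace : ∀ {y} → Solution lam w y 0# → Eigenspace ℝ A lam (y ∘ position)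
      Solution⇒Eigenspace {y} S i = ≡.subst
        (λ i → sum (λ j → A i j * y (position j)) ≈ lam * y (position i)) (label-position i) (begin
          sum (λ j → A (label v) j * y (position j))   ≈⟨ matrix-row (y ∘ position) v ⟩
          row w (y ∘ position ∘ label) v               ≈⟨ row-cong w y-label v ⟩
          row w y v                                    ≈⟨ S v ⟩
          lam * y v + δ v * 0#                         ≈⟨ trans (+-congˡ (zeroʳ _)) (+-identityʳ _) ⟩
          lam * y v                                    ≈⟨ *-congˡ (sym (y-label v)) ⟩
          lam * y (position (label v))                 ∎)
        where
        v = position i
        y-label : ∀ u → y (position (label u)) ≈ y u
        y-label u = reflexive (≡.cong y (position-label u))

      multiplicity : ∀ {m} → Nullity {lam} w m → HasMultiplicity ℝ A lam m
      multiplicity N = multiplicity-by-coordinates (label ∘ at-C)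
        (λ f → let (x , S , c) = kernel f in x ∘ position , Solution⇒Eigenspace S ,
          λ i → trans (reflexive (≡.cong x (position-label (at-C i)))) (c i))
        (λ x E z i → trans (reflexive (≡.cong x (≡.sym (label-position i))))
          (trivial (x ∘ label) (Eigenspace⇒Solution E) z (position i)))
        where open Coordinates (coordinates N) renaming (position to at-C)

    matrix : Weights tree → Matrix ℝ n
    matrix w i j = entry w (position i) (position j)

    represents-matrix : ∀ w → w Represents matrix w
    represents-matrix w u v = reflexive (≡.cong₂ (entry w) (position-label u) (position-label v))

    position-injective : ∀ {i j} → position i ≡ position j → i ≡ j
    position-injective {i} {j} eq =
      ≡.trans (≡.sym (label-position i)) (≡.trans (≡.cong label eq) (label-position j))

    adj-position : ∀ {i j} → Adj i j ⇔ Edge (position i) (position j)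
    adj-position {i} {j} = mk⇔
      (λ a → edge (≡.subst₂ Adj (≡.sym (label-position i)) (≡.sym (label-position j)) a))
      (λ e → ≡.subst₂ Adj (label-position i) (label-position j) (adjacent e))

    matrix-𝒮 : ∀ w → 𝒮 ℝ T (matrix w)
    matrix-𝒮 w = record
      { symmetric = λ i j → entry-sym w (position i) (position j)
      ; support = λ i j i≢j → mk⇔
          (λ nz → Equivalence.from adj-position (edge-entry w (i≢j ∘ position-injective) nz))
          (λ a → entry-edge w (Equivalence.to adj-position a)) }

    weightsOf-𝒮 : ∀ {A} → 𝒮 ℝ T A → ∃[ w ] w Represents A
    weightsOf-𝒮 {A} S with weightsOf (λ u v → A (label u) (label v))
        (λ u v → symmetric (label u) (label v))
        (λ {u} {v} e → Equivalence.from (support _ _ (λ eq → irrefl eq (adjacent e))) (adjacent e))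
        offEdge
      where
      open 𝒮 S
      offEdge : ∀ {u v} → u ≢ v → ¬ Edge u v → A (label u) (label v) ≈ 0#
      offEdge {u} {v} u≢v ¬e with zero? (A (label u) (label v))
      ... | yes z = z
      ... | no nz = ⊥-elim (¬e (edge (Equivalence.to (support _ _ (u≢v ∘ injective)) nz)))
    ... | w , eq = w , λ u v → sym (eq u v)

  -- Leaves of a star shared by two eigenvalues.

  infinite : Pivot → ℕ
  infinite (fin _) = 0
  infinite ∞       = 1

  -- In a flat tree `n ℕ.+ infinite σ` counts the leaves with vanishing pivot, including the one
  -- paired with the centre; such a leaf has diagonal entry `lam`.
  elim-leaf : ∀ {lam t} {w : Weights t} {a a≉0 d n σ} → Elim lam (join w a a≉0 (vertex d)) n σ →
    ∃[ n₁ ] ∃[ σ₁ ] Elim lam w n₁ σ₁ ×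
      (n ℕ.+ infinite σ ≡ n₁ ℕ.+ infinite σ₁ ⊎
       n ℕ.+ infinite σ ≡ suc (n₁ ℕ.+ infinite σ₁) × lam ≈ d)
  elim-leaf (schur {n = n} D (leaf _) _ _) = _ , _ , D , inj₁ (≡.cong (ℕ._+ 0) (ℕ.+-identityʳ n))
  elim-leaf (keep {n = n} D (leaf _) _) = _ , _ , D , inj₁ (≡.cong (ℕ._+ 1) (ℕ.+-identityʳ n))
  elim-leaf {lam} (kill {n = n} D (leaf p) z) = _ , _ , D , inj₂
    (≡.trans (≡.cong (ℕ._+ 1) (ℕ.+-identityʳ n)) (≡.trans (ℕ.+-comm n 1) (≡.cong suc (≡.sym (ℕ.+-identityʳ n)))) ,
     trans (sym (+-identityˡ lam)) (trans (+-congʳ (sym z)) p))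
  elim-leaf {lam} (gain {n = n} D (leaf p) z) = _ , _ , D , inj₂
    (≡.cong (λ k → suc (k ℕ.+ 1)) (ℕ.+-identityʳ n) ,
     trans (sym (+-identityˡ lam)) (trans (+-congʳ (sym z)) p))

  -- The two counts are of disjoint sets of leaves, since the diagonal entry of a leaf equals at
  -- most one of μ and ν.
  two-eigenvalues : ∀ {μ ν t} → ¬ (ν ≈ μ) → (f : Flat t) {w : Weights t} → ∀ {n n′ σ σ′} →
    Elim μ w n σ → Elim ν w n′ σ′ → (n ℕ.+ infinite σ) ℕ.+ (n′ ℕ.+ infinite σ′) ℕ.≤ leaves f
  two-eigenvalues ν≉μ • (leaf _) (leaf _) = z≤n
  two-eigenvalues ν≉μ (f ◁•) {join w a a≉0 (vertex d)} D E with elim-leaf D | elim-leaf E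
  ... | n , σ , D₁ , inj₁ p | n′ , σ′ , E₁ , inj₁ q rewrite p | q =
    ℕ.m≤n⇒m≤1+n (two-eigenvalues ν≉μ f D₁ E₁)
  ... | n , σ , D₁ , inj₂ (p , _) | n′ , σ′ , E₁ , inj₁ q rewrite p | q =
    s≤s (two-eigenvalues ν≉μ f D₁ E₁)
  ... | n , σ , D₁ , inj₁ p | n′ , σ′ , E₁ , inj₂ (q , _)
    rewrite p | q | ℕ.+-suc (n ℕ.+ infinite σ) (n′ ℕ.+ infinite σ′) =
    s≤s (two-eigenvalues ν≉μ f D₁ E₁)
  ... | n , σ , D₁ , inj₂ (_ , μ≈d) | n′ , σ′ , E₁ , inj₂ (_ , ν≈d) = ⊥-elim (ν≉μ (trans ν≈d (sym μ≈d)))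

  flat-finite : ∀ {lam t} → Flat t → {w : Weights t} → ∀ {n d} → Elim lam w n (fin d) → n ≡ 0
  flat-finite • (leaf _) = ≡.refl
  flat-finite (f ◁•) (schur {n = n} D (leaf _) _ _) = ≡.trans (ℕ.+-identityʳ n) (flat-finite f D)

  -- With diagonal 0 all leaf pivots vanish at 0; this bounds M from below in `leaves≤`.
  star-realised : ∀ {t} (f : Flat t) → leaves f ≡ 0 × (∃ λ (w : Weights t) → Elim 0# w 0 (fin 0#)) ⊎
    ∃[ n ] leaves f ≡ suc n × (∃ λ (w : Weights t) → Elim 0# w n ∞)
  star-realised • = inj₁ (≡.refl , vertex 0# , leaf (+-identityʳ 0#))
  star-realised (f ◁•) with star-realised f
  ... | inj₁ (eq , w , D) = inj₂ (0 , ≡.cong suc eq , join w 1# 1≉0 (vertex 0#) ,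
    kill D (leaf (+-identityʳ 0#)) refl)
  ... | inj₂ (n , eq , w , D) = inj₂ (suc n , ≡.cong suc eq , join w 1# 1≉0 (vertex 0#) ,
    ≡.subst (λ k → Elim 0# _ (suc k) ∞) (ℕ.+-identityʳ n) (gain D (leaf (+-identityʳ 0#)) refl))

  nullity-exists : ∀ lam {t} (w : Weights t) → ∃[ m ] Nullity {lam} w m
  nullity-exists lam w with eliminate lam w
  ... | n , σ , D with vanishes-or-reciprocal σ
  ... | inj₁ z = suc n , σ , inj₂ (n , D , z , ≡.refl)
  ... | inj₂ r = n , σ , inj₁ (D , r)

  multiplicity⇒eigenvalue : ∀ {n} {A : Matrix ℝ n} {μ m} → HasMultiplicity ℝ A μ (suc m) → IsEigenvalue ℝ A μ
  multiplicity⇒eigenvalue {A = A} H = basis zero , inside zero , λ z →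
    1≉0 (independent (unitVector zero) (λ i → trans
      (+-cong (trans (*-identityˡ _) (z i)) (sum-zero _ (λ r → zeroˡ (basis (suc r) i)))) (+-identityˡ 0#)) zero)
    where open HasMultiplicity H

  eigenvalue⇒multiplicity : ∀ {n} {A : Matrix ℝ n} {μ} → IsEigenvalue ℝ A μ → ¬ HasMultiplicity ℝ A μ 0
  eigenvalue⇒multiplicity (x , E , nz) H = nz (proj₂ (HasMultiplicity.spanning H x E))

  maximum-unique : ∀ {n} {T : Graph n} {M M′} →
    IsMaxMultiplicity ℝ T M → IsMaxMultiplicity ℝ T M′ → M ≡ M′
  maximum-unique p q = ℕ.≤-antisym (below p q) (below q p)
    where
    below : ∀ {M M′} → IsMaxMultiplicity ℝ _ M → IsMaxMultiplicity ℝ _ M′ → M ℕ.≤ M′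
    below p q = let (A , S , μ , H) = IsMaxMultiplicity.attained p in IsMaxMultiplicity.maximal q A S μ _ H

  -- The two implications.

  module _ {n : ℕ} {T : Graph n} (isTree : IsTree T)
           {M : ℕ} (isMax : IsMaxMultiplicity ℝ T M) (4≤M : 4 ℕ.≤ M) where
    open Graph T

    private
      enc = encode em T isTree (fromℕ< (IsTree.nonEmpty isTree))
      open Encoding enc using (tree; label)

    starlike⇒star : Starlike tree → IsSimpleStar T
    starlike⇒star starlike with starlike-centre starlike
    ... | c , to-c , from-c = label c , λ i j → mk⇔
        (λ a → (λ i≡j → irrefl i≡j a) , to-centre (Equivalence.to (adj-position enc) a))
        (λ { (i≢j , inj₁ ≡.refl) → from-centre j (i≢j ∘ ≡.sym)
           ; (i≢j , inj₂ ≡.refl) → symm (from-centre i i≢j) })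
      where
      at-c : ∀ {i} → position enc i ≡ c → i ≡ label c
      at-c eq = ≡.trans (≡.sym (label-position enc _)) (≡.cong label eq)
      to-centre : ∀ {i j} → Edge (position enc i) (position enc j) → i ≡ label c ⊎ j ≡ label c
      to-centre e with to-c e
      ... | inj₁ eq = inj₁ (at-c eq)
      ... | inj₂ eq = inj₂ (at-c eq)
      from-centre : ∀ j → j ≢ label c → Adj (label c) j
      from-centre j j≢c = Equivalence.from (adj-position enc)
        (≡.subst (λ u → Edge u (position enc j)) (≡.sym (position-label enc c)) (from-c _ (j≢c ∘ at-c)))

    counterexample⇒¬NIM : Counterexample tree M → ¬ Is3NIM ℝ T
    counterexample⇒¬NIM record { weights = w ; at0 = N ; at-1 = N′ ; 2≤k = s≤s (s≤s _) } nim =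
      2+k≢1 (multiplicity-unique H′ (Is3NIM.simple nim (matrix enc w) (matrix-𝒮 enc w) 0#
        (≡.subst (λ M → HasMultiplicity ℝ (matrix enc w) 0# (M ∸ 2)) M≡
          (multiplicity enc (represents-matrix enc w) 0# N))
        (≡.subst (λ M → 2 ℕ.≤ M ∸ 2) M≡ (ℕ.∸-monoˡ-≤ 2 4≤M))
        (- 1#) -1≉0 (multiplicity⇒eigenvalue H′)))
      where
      M≡ = maximum-unique isMax (Is3NIM.isMax nim)
      H′ = multiplicity enc (represents-matrix enc w) (- 1#) N′
      -1≉0 : ¬ (- 1# ≈ 0#)
      -1≉0 eq = 1≉0 (trans (solve 0 (:1 := :- (:- :1)) refl) (trans (-‿cong eq) (solve 0 (:- :0 := :0) refl)))
      2+k≢1 : ∀ {k} → suc (suc k) ≢ 1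
      2+k≢1 ()

    NIM⇒star : Is3NIM ℝ T → IsSimpleStar T
    NIM⇒star nim with IsMaxMultiplicity.attained isMax
    ... | A , S , μ , H with weightsOf-𝒮 enc S
    ... | w , rep with nullity-exists μ w
    ... | m , N with multiplicity-unique H (multiplicity enc rep μ N)
    ... | ≡.refl with counterexample-or-star N 4≤M
    ... | inj₁ c    = ⊥-elim (counterexample⇒¬NIM c nim)
    ... | inj₂ star = starlike⇒star star

  module _ {n : ℕ} {T : Graph n} (isTree : IsTree T)
           {M : ℕ} (isMax : IsMaxMultiplicity ℝ T M) (4≤M : 4 ℕ.≤ M) where
    open Graph T

    star⇒NIM : IsSimpleStar T → Is3NIM ℝ T
    star⇒NIM (z , star) = record { M = M ; isMax = isMax ; 3≤M = ℕ.≤-trans (ℕ.n≤1+n 3) 4≤M ; simple = simple }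
      where
      enc = encode em T isTree z
      open Encoding enc

      at-root : ∀ {u} → label u ≡ z → u ≡ root tree
      at-root eq = injective (≡.trans eq (≡.sym label-root))

      flat : Flat tree
      flat = to-root-flat tree to-root
        where
        to-root : ∀ {u v} → Edge {tree} u v → u ≡ root tree ⊎ v ≡ root tree
        to-root e with proj₂ (Equivalence.to (star _ _) (adjacent e))
        ... | inj₁ eq = inj₁ (at-root eq)
        ... | inj₂ eq = inj₂ (at-root eq)

      leaves≤ : leaves flat ℕ.≤ suc M
      leaves≤ with star-realised flat
      ... | inj₁ (eq , _) = ≡.subst (ℕ._≤ suc M) (≡.sym eq) z≤n
      ... | inj₂ (k , eq , w , D) = ≡.subst (ℕ._≤ suc M) (≡.sym eq) (s≤s
        (IsMaxMultiplicity.maximal isMax _ (matrix-𝒮 enc w) 0# k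
          (multiplicity enc (represents-matrix enc w) 0# (nullity-∞ D))))

      -- When m + 1 of the at most M + 1 leaves have vanishing pivot at μ, at most two are left for
      -- ν. One of those is paired with the centre, so the multiplicity of ν is at most 1.
      few-left : ∀ {m x} → 4 ℕ.≤ M → m ≡ M ∸ 2 → (m ℕ.+ 1) ℕ.+ x ℕ.≤ leaves flat → x ℕ.≤ 2
      few-left {x = x} (s≤s (s≤s {n = M₁} _)) ≡.refl le = ℕ.+-cancelˡ-≤ (suc M₁) x 2
        (ℕ.≤-trans (ℕ.≤-reflexive (≡.cong (ℕ._+ x) (ℕ.+-comm 1 M₁)))
          (ℕ.≤-trans le (ℕ.≤-trans leaves≤ (ℕ.≤-reflexive (≡.cong suc (ℕ.+-comm 2 M₁))))))

      simple : ∀ A → 𝒮 ℝ T A → ∀ μ → HasMultiplicity ℝ A μ (M ∸ 2) → 2 ℕ.≤ M ∸ 2 →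
               ∀ ν → ¬ (ν ≈ μ) → IsEigenvalue ℝ A ν → HasMultiplicity ℝ A ν 1
      simple A S μ H 2≤ ν ν≉μ eig with weightsOf-𝒮 enc S
      ... | w , rep with nullity-exists μ w | nullity-exists ν w
      ... | m , N | k , N′ = ≡.subst (HasMultiplicity ℝ A ν) k≡1 Hν
        where
        Hμ = multiplicity enc rep μ N
        Hν = multiplicity enc rep ν N′

        m≡ : m ≡ M ∸ 2
        m≡ = multiplicity-unique Hμ H

        at-most-one : Nullity {μ} w m → Nullity {ν} w k → k ℕ.≤ 1
        -- If the centre has a finite pivot at ν, no leaf contributes, and only the centre itself
        -- can.
        at-most-one _ (fin _ , inj₁ (E , _)) = ℕ.≤-trans (ℕ.≤-reflexive (flat-finite flat E)) z≤n
        at-most-one _ (fin _ , inj₂ (_ , E , _ , ≡.refl)) = s≤s (ℕ.≤-reflexive (flat-finite flat E))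
        at-most-one (∞ , inj₁ (D , _)) (∞ , inj₁ (E , _)) = ℕ.+-cancelʳ-≤ 1 k 1
          (few-left 4≤M m≡ (two-eigenvalues ν≉μ flat D E))
        -- A finite pivot of the centre at μ would leave multiplicity at most 1 there, against `2≤`.
        at-most-one (fin _ , inj₁ (D , _)) _ with flat-finite flat D
        ... | ≡.refl = ⊥-elim (ℕ.<⇒≱ 2≤ (ℕ.≤-trans (ℕ.≤-reflexive (≡.sym m≡)) z≤n))
        at-most-one (fin _ , inj₂ (_ , D , _ , ≡.refl)) _ with flat-finite flat D
        ... | ≡.refl = ⊥-elim (ℕ.<⇒≱ 2≤ (ℕ.≤-reflexive (≡.sym m≡)))

        k≡1 : k ≡ 1
        k≡1 = ℕ.≤-antisym (at-most-one N N′) (positive Hν)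
          where
          positive : ∀ {k} → HasMultiplicity ℝ A ν k → 1 ℕ.≤ k
          positive {zero}  H = ⊥-elim (eigenvalue⇒multiplicity eig H)
          positive {suc _} _ = s≤s z≤n

open import Data.Nat.Base using (_≤_)

theorem2p4 : ExcludedMiddle 0ℓ → (ℝ : RealNumbers) →
    ∀ (n : ℕ) (T : Graph n) → IsTree T →
    ∀ (M : ℕ) → IsMaxMultiplicity ℝ T M → 4 ≤ M →
    Is3NIM ℝ T ⇔ IsSimpleStar T
theorem2p4 em ℝ n T isTree M isMax 4≤M = mk⇔ (NIM⇒star isTree isMax 4≤M) (star⇒NIM isTree isMax 4≤M)
  where open OverReals em ℝ
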